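{- Let $\alpha$ be a composition of $n$ and let $\mathscr E:=D(X_\alpha,\mathrm w_{RB})$. (a) $C_{X_\alpha}=\{\Sigma_L(P_{T^x}):T\in\mathsf{ST}(\mathscr E^x)\}$. Furthermore, $$\min C_{X_\alpha}=[w_0(\mathrm{set}(\alpha)^c),\mathrm w_{RB}(\mathsf T'_\alpha)]_L\quad\text{and}\quad \max C_{X_\alpha}=[\mathrm w_{BR}(\mathsf T_\alpha),w_1(\mathrm{set}((\tilde\alpha')^{r}))]_L .$$ (b) $(C_{X_\alpha},\preceq)\cong(\mathsf{ST}(\mathscr E^x),\trianglelefteq)$ as posets.
   Context: Permutations. $n$ is a positive integer, $[n]=\{1,\dots,n\}$, $\mathfrak S_n$ the symmetric group (product = composition of maps; permutations written as words), $s_i=(i,i+1)$, $\ell(\sigma)$ Coxeter length, $w_0$ the longest element. $\mathrm{Des}_L(\sigma)=\{i:\ell(s_i\sigma)<\ell(\sigma)\}$, $\mathrm{Des}_R(\sigma)=\{i:\ell(\sigma s_i)<\ell(\sigma)\}$. $\preceq_L$ (resp. $\preceq_R$) has covers $\sigma\prec s_i\sigma$, $i\notin\mathrm{Des}_L(\sigma)$ (resp. $\sigma\prec\sigma s_i$, $i\notin\mathrm{Des}_R(\sigma)$); $[\sigma,\rho]_L$ is the interval for $\preceq_L$. For $S\subseteq[n-1]$, $S^{c}=[n-1]\setminus S$; $w_0(S)$ is the longest element of the subgroup generated by $\{s_i:i\in S\}$; $w_1(S)=w_0w_0(S^c)$ is the longest element of $\{z:\mathrm{Des}_R(z)\subseteq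 S\}$. For a composition $\alpha=(\alpha_1,\dots,\alpha_l)$ of $n$, $\ell(\alpha)=l$, $\mathrm{set}(\alpha)=\{\alpha_1,\dots,\alpha_1+\dots+\alpha_{l-1}\}$, $\alpha^r=(\alpha_l,\dots,\alpha_1)$, $\tilde\alpha$ is the partition obtained by sorting $\alpha$ weakly decreasingly, and $\tilde\alpha'$ is its conjugate partition. Classes. For nonempty left weak Bruhat intervals, $I_1\sim_D I_2$ iff there is a poset isomorphism $f:(I_1,\preceq_L)\to(I_2,\preceq_L)$ with $\mathrm{Des}_L(f(\gamma))=\mathrm{Des}_L(\gamma)$ for all $\gamma$. On a class $C$ put $[\sigma,\rho]_L\preceq[\sigma',\rho']_L$ iff $\sigma\preceq_R\sigma'$; it is known that $(C,\preceq)$ has a minimum and a maximum. Diagrams and fillings. Boxes are $(x,y)\in\mathbb Z_{>0}^2$ with $x$ = column from the left, $y$ = row from the bottom. For a diagram $D$ with $n$ boxes and no empty rows/columns, a standard filling is a bijection $F:D\to[n]$; $P_F$ is the poset on $[n]$ with $i\preceq j$ iff $x_i\le x_j$ and $y_i\le y_j$, where $(x_i,y_i)=F^{ -1}(i)$; $\Sigma_L(P)=\{\sigma\in\mathfrak S_n:\sigma(i)\le\sigma(j)\text{ whenever }i\preceq_Pj\}$. $\mathsf{ST}(D)$: standard fillings $T$ with $T(i,j)\le T(k,l)$ whenever $i\le k$, $j\le l$, ordered by $T\trianglelefteq U$ iff $\mathrm w_{TL}(T)\preceq_L\mathrm w_{TL}(U)$, where $\mathrm w_{TL}$ reads each column top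 to bottom, leftmost column first. $D^x$, $T^x$: reflection across the $x$-axis (shifted upward to the first quadrant, touching the axes). Tableaux. $\mathrm{tcd}(\alpha)=\{(j,i):1\le i\le\ell(\alpha),1\le j\le\alpha_i\}$. A standard extended tableau (SET) of shape $\alpha$ is a bijective filling of $\mathrm{tcd}(\alpha)$ by $[n]$ with rows increasing left to right and every column increasing bottom to top. $\mathrm w_{RB}$ reads each row right to left, bottom row first; $\mathrm w_{BR}$ reads each column bottom to top, rightmost column first. $\mathsf T_\alpha$ is the SET filled with $1,\dots,n$ along rows left to right, bottom row first. $\mathsf T'_\alpha$ is the SET filled with $1,\dots,n$ up each column (bottom to top), leftmost column first. $C_{X_\alpha}$ is the $\sim_D$-class of $\{\mathrm w_{RB}(T):T\text{ an SET of shape }\alpha\}$, which is known to be the interval $[w_0(\mathrm{set}(\alpha)^c),\mathrm w_{RB}(\mathsf T'_\alpha)]_L$ ($X_\alpha$ is Searles's $H_n(0)$-module on SETs whose quasisymmetric characteristic is the extended Schur function). $D(X_\alpha,\mathrm w_{RB})=\{(j,i):(i,j)\in\mathrm{tcd}(\alpha)\}$, the transpose of $\mathrm{tcd}(\alpha)$. -}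

module Defs where

open import Data.Bool.Base using (Bool; T)
open import Data.Bool.Properties using (T?; T-irrelevant)
open import Data.Fin.Base as Fin using (Fin; zero; suc; toℕ; inject₁; opposite)
open import Data.Fin.Permutation as Perm
  using (Permutation′; _⟨$⟩ʳ_; _⟨$⟩ˡ_; _≈_; _∘ₚ_; cast-id; ↔⇒≡)
open import Data.Fin.Properties using (opposite-involutive)
open import Data.List.Base as List
  using (List; []; _∷_; length; take; filter; lookup; allFin; tabulate; upTo;
         cartesianProduct; cartesianProductWith; _++_)
open import Data.List.Extrema.Nat using (max; xs≤max)
open import Data.List.Membership.Propositional using () renaming (_∈_ to _∈ₗ_)
open import Data.List.Membership.Propositional.Properties
  using (∈-lookup; ∈-tabulate⁺; ∈-cartesianProductWith⁺; ∈-filter⁺; ∈-filter⁻)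
open import Data.List.Properties
  using (length-++; filter-++; map-tabulate; tabulate-lookup)
open import Data.List.Relation.Unary.All as All using (All)
open import Data.List.Relation.Unary.AllPairs using ([]; _∷_)
open import Data.List.Relation.Unary.Any using (here; there; index)
open import Data.List.Relation.Unary.Any.Properties using (lookup-index)
open import Data.List.Relation.Unary.Unique.Propositional using (Unique)
import Data.List.Relation.Unary.Unique.Propositional.Properties as Uniqueₚ
import Data.List.Sort as Sort
open import Data.Nat.Base using (ℕ; zero; suc; pred; _+_; _<_; _≤_; _<ᵇ_; z≤n; s≤s)
open import Data.Nat.ListAction using (sum)
open import Data.Nat.Properties using (_<?_; ≤-decTotalOrder)
open import Data.Product.Base using (∃; ∃₂; ∃-syntax; Σ-syntax; _×_; _,_; proj₁; proj₂; swap)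
open import Data.Sum.Base using (_⊎_)
open import Function.Base using (_∘_; _on_)
open import Function.Bundles using (_↔_; Inverse; Injection; mk↔ₛ′)
open import Function.Construct.Composition using (_↔-∘_)
open import Function.Construct.Symmetry using (↔-sym)
open import Function.Properties.Inverse using (↔⇒↣)
open import Level using (0ℓ)
open import Relation.Binary.Core using (Rel)
open import Relation.Binary.Construct.Closure.ReflexiveTransitive using (Star)
import Relation.Binary.Construct.Flip.EqAndOrd as Flip
open import Relation.Binary.Morphism.Structures using (IsOrderIsomorphism)
open import Relation.Binary.PropositionalEquality
  using (_≡_; refl; sym; trans; cong; cong₂; subst; module ≡-Reasoning)
open import Relation.Nullary using (¬_; does)
open import Relation.Unary using (Pred; U; ∁; _∈_; _≐_)

private
  variable
    n w h : ℕ

-- Everything is indexed from zero: [n] is Fin n and the index set [n-1]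
-- of the simple reflections is Fin (pred n).

𝔖 : ℕ → Set
𝔖 n = Permutation′ n

infixl 7 _·_

-- (σ · τ)(i) = σ(τ(i)); the library's _∘ₚ_ composes in the other order.
_·_ : 𝔖 n → 𝔖 n → 𝔖 n
σ · τ = τ ∘ₚ σ

s : Fin (pred n) → 𝔖 n
s {suc n} i = Perm.transpose (inject₁ i) (suc i)

product : List (Fin (pred n)) → 𝔖 n
product []       = Perm.id
product (i ∷ is) = s i · product is

-- k is the Coxeter length of σ: the least number of factors in an
-- expression of σ as a product of simple reflections.
IsLength : 𝔖 n → ℕ → Set
IsLength σ k =
    (∃[ is ] length is ≡ k × product is ≈ σ)
  × (∀ is → product is ≈ σ → k ≤ length is)

infix 4 _<ℓ_
_<ℓ_ : Rel (𝔖 n) 0ℓ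
σ <ℓ τ = ∃₂ λ k m → IsLength σ k × IsLength τ m × k < m

Des-L Des-R : 𝔖 n → Pred (Fin (pred n)) 0ℓ
Des-L σ i = s i · σ <ℓ σ
Des-R σ i = σ · s i <ℓ σ

infix 4 _⋖L_ _⋖R_ _⪯L_ _⪯R_

_⋖L_ _⋖R_ : Rel (𝔖 n) 0ℓ
σ ⋖L τ = ∃[ i ] ¬ Des-L σ i × τ ≈ s i · σ
σ ⋖R τ = ∃[ i ] ¬ Des-R σ i × τ ≈ σ · s i

-- Equality of permutations is the pointwise _≈_, so reflexivity of the
-- weak orders has to be closed under it.
_⪯L_ _⪯R_ : Rel (𝔖 n) 0ℓ
_⪯L_ = Star (λ σ τ → σ ≈ τ ⊎ σ ⋖L τ)
_⪯R_ = Star (λ σ τ → σ ≈ τ ⊎ σ ⋖R τ)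

-- The subgroup of 𝔖 n generated by the s i with i ∈ S.
data ⟨_⟩ {n : ℕ} (S : Pred (Fin (pred n)) 0ℓ) : Pred (𝔖 n) 0ℓ where
  gen  : ∀ {i} → i ∈ S → s i ∈ ⟨ S ⟩
  unit : Perm.id ∈ ⟨ S ⟩
  mult : ∀ {σ τ : 𝔖 n} → σ ∈ ⟨ S ⟩ → τ ∈ ⟨ S ⟩ → σ · τ ∈ ⟨ S ⟩
  inv  : ∀ {σ : 𝔖 n} → σ ∈ ⟨ S ⟩ → Perm.flip σ ∈ ⟨ S ⟩
  resp : ∀ {σ τ : 𝔖 n} → σ ≈ τ → σ ∈ ⟨ S ⟩ → τ ∈ ⟨ S ⟩

-- σ is the longest element of P; uniqueness is part of the definition.
IsLongest : Pred (𝔖 n) 0ℓ → Pred (𝔖 n) 0ℓ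
IsLongest P σ = σ ∈ P × (∀ τ → τ ∈ P → τ ≈ σ ⊎ τ <ℓ σ)

-- σ = w₀, σ = w₀(S) and σ = w₁(S) = w₀ w₀(Sᶜ), respectively.
Is-w₀ : Pred (𝔖 n) 0ℓ
Is-w₀ = IsLongest U

Is-w₀⟨_⟩ Is-w₁⟨_⟩ : Pred (Fin (pred n)) 0ℓ → Pred (𝔖 n) 0ℓ
Is-w₀⟨ S ⟩   = IsLongest ⟨ S ⟩
Is-w₁⟨ S ⟩ σ = ∃₂ λ u v → Is-w₀ u × Is-w₀⟨ ∁ S ⟩ v × σ ≈ u · v

[_,_]L : 𝔖 n → 𝔖 n → Pred (𝔖 n) 0ℓ
[ σ , ρ ]L γ = σ ⪯L γ × γ ⪯L ρ

-- Nonempty intervals only.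
record LeftInterval (n : ℕ) : Set where
  field
    bot top : 𝔖 n
    bot⪯top : bot ⪯L top

open LeftInterval public

⟦_⟧ : LeftInterval n → Pred (𝔖 n) 0ℓ
⟦ I ⟧ = [ bot I , top I ]L

infix 4 _∼D_
_∼D_ : Pred (𝔖 n) 0ℓ → Pred (𝔖 n) 0ℓ → Set
I ∼D J = Σ[ f ∈ (∃ I → ∃ J) ]
    IsOrderIsomorphism (_≈_ on proj₁) (_≈_ on proj₁) (_⪯L_ on proj₁) (_⪯L_ on proj₁) f
  × (∀ γ → Des-L (proj₁ (f γ)) ≐ Des-L (proj₁ γ))

Class : Pred (𝔖 n) 0ℓ → Pred (LeftInterval n) 0ℓ
Class X I = ⟦ I ⟧ ∼D X

infix 4 _≈I_ _⪯I_

_≈I_ _⪯I_ : Rel (LeftInterval n) 0ℓ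
I ≈I J = ⟦ I ⟧ ≐ ⟦ J ⟧
I ⪯I J = bot I ⪯R bot J

-- A class regarded as a family of subsets of 𝔖 n.
Members : Pred (LeftInterval n) 0ℓ → Pred (Pred (𝔖 n) 0ℓ) 0ℓ
Members C X = ∃[ I ] I ∈ C × ⟦ I ⟧ ≐ X

MinIs MaxIs : Pred (LeftInterval n) 0ℓ → Pred (𝔖 n) 0ℓ → Set
MinIs C X = ∃[ I ] I ∈ C × (∀ J → J ∈ C → I ⪯I J) × ⟦ I ⟧ ≐ X
MaxIs C X = ∃[ I ] I ∈ C × (∀ J → J ∈ C → J ⪯I I) × ⟦ I ⟧ ≐ X

-- The first coordinate of a box is its column, counted from the left,
-- the second one its row, counted from the bottom, both from zero.  A
-- diagram is a set of boxes inside a w × h rectangle; it has no empty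
-- rows or columns precisely when that rectangle is its bounding box.

Box : ℕ → ℕ → Set
Box w h = Fin w × Fin h

Diagram : ℕ → ℕ → Set
Diagram w h = Box w h → Bool

Cell : Diagram w h → Set
Cell D = Σ[ b ∈ Box _ _ ] T (D b)

_ᵀ : Diagram w h → Diagram h w
(D ᵀ) b = D (swap b)

-- Reflection across the x-axis, shifted back up into the first quadrant.
_ˣ : Diagram w h → Diagram w h
(D ˣ) (x , y) = D (x , opposite y)

Filling : Diagram w h → ℕ → Set
Filling D n = Cell D ↔ Fin n

cell-≡ : {D : Diagram w h} {b c : Cell D} → proj₁ b ≡ proj₁ c → b ≡ c
cell-≡ {b = b , p} {.b , q} refl = cong (b ,_) (T-irrelevant p q)

reflectCell : (D : Diagram w h) → Cell (D ˣ) ↔ Cell D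
reflectCell D = mk↔ₛ′
  (λ ((x , y) , p) → (x , opposite y) , p)
  (λ ((x , y) , p) → (x , opposite y) ,
                     subst (λ z → T (D (x , z))) (sym (opposite-involutive y)) p)
  (λ ((x , y) , _) → cell-≡ {D = D} (cong (x ,_) (opposite-involutive y)))
  (λ ((x , y) , _) → cell-≡ {D = D ˣ} (cong (x ,_) (opposite-involutive y)))

reflect : {D : Diagram w h} → Filling D n → Filling (D ˣ) n
reflect {D = D} F = F ↔-∘ reflectCell D

infix 4 _≤B_
_≤B_ : Rel (Box w h) 0ℓ
(x , y) ≤B (x′ , y′) = x Fin.≤ x′ × y Fin.≤ y′

P : {D : Diagram w h} → Filling D n → Rel (Fin n) 0ℓ
P F i j = proj₁ (Inverse.from F i) ≤B proj₁ (Inverse.from F j)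

Σ-L : Rel (Fin n) 0ℓ → Pred (𝔖 n) 0ℓ
Σ-L _⪯_ σ = ∀ i j → i ⪯ j → σ ⟨$⟩ʳ i Fin.≤ σ ⟨$⟩ʳ j

-- An enumeration of all boxes of the w × h rectangle without repetitions.
record ReadingOrder (w h : ℕ) : Set where
  field
    boxes    : List (Box w h)
    complete : ∀ b → b ∈ₗ boxes
    unique   : Unique boxes

open ReadingOrder

-- A direction of reading along an axis is a permutation of the positions.
forwards backwards : 𝔖 n
forwards  = Perm.id
backwards = Perm.reverse

positions : 𝔖 n → List (Fin n)
positions π = tabulate (π ⟨$⟩ʳ_)

positions-complete : (π : 𝔖 n) → ∀ i → i ∈ₗ positions π
positions-complete π i =
  subst (_∈ₗ positions π) (Perm.inverseʳ π) (∈-tabulate⁺ (π ⟨$⟩ˡ i))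

positions-unique : (π : 𝔖 n) → Unique (positions π)
positions-unique π = Uniqueₚ.tabulate⁺ (Injection.injective (↔⇒↣ π))

columnByColumn rowByRow : (horizontally : 𝔖 w) (vertically : 𝔖 h) → ReadingOrder w h
columnByColumn dx dy = record
  { boxes    = cartesianProduct (positions dx) (positions dy)
  ; complete = λ (x , y) →
      ∈-cartesianProductWith⁺ _,_ (positions-complete dx x) (positions-complete dy y)
  ; unique   = Uniqueₚ.cartesianProduct⁺ (positions-unique dx) (positions-unique dy)
  }
rowByRow dx dy = record
  { boxes    = cartesianProductWith (λ y x → x , y) (positions dy) (positions dx)
  ; complete = λ (x , y) →
      ∈-cartesianProductWith⁺ (λ y x → x , y) (positions-complete dy y) (positions-complete dx x)
  ; unique   = Uniqueₚ.cartesianProductWith⁺ (λ y x → x , y) (λ { refl → refl , refl })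
      (positions-unique dy) (positions-unique dx)
  }

index-lookup : ∀ {a} {A : Set a} {xs : List A} → Unique xs →
               ∀ k (p : lookup xs k ∈ₗ xs) → index p ≡ k
index-lookup (x∉xs ∷ xs!) zero    (here _)  = refl
index-lookup (x∉xs ∷ xs!) zero    (there p) with () ← All.lookup x∉xs p refl
index-lookup (x∉xs ∷ xs!) (suc k) (here q)
  with () ← All.lookup x∉xs (∈-lookup k) (sym q)
index-lookup (x∉xs ∷ xs!) (suc k) (there p) = cong suc (index-lookup xs! k p)

-- The boxes of D in the given order, and the bijection k ↦ k-th such box.
listed : ReadingOrder w h → Diagram w h → List (Box w h)
listed o D = filter (T? ∘ D) (boxes o)

enumerate : (o : ReadingOrder w h) (D : Diagram w h) → Fin (length (listed o D)) ↔ Cell D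
enumerate o D = mk↔ₛ′
  (λ k → lookup (listed o D) k , proj₂ (∈-filter⁻ (T? ∘ D) {xs = boxes o} (∈-lookup k)))
  (λ (b , p) → index (mem b p))
  (λ (b , p) → cell-≡ {D = D} (sym (lookup-index (mem b p))))
  (λ k → index-lookup (Uniqueₚ.filter⁺ (T? ∘ D) (unique o)) k _)
  where
  mem : ∀ b → T (D b) → b ∈ₗ listed o D
  mem b p = ∈-filter⁺ (T? ∘ D) (complete o b) p

-- The reading word, as a permutation: k ↦ entry of the k-th box read.
word : ReadingOrder w h → {D : Diagram w h} → Filling D n → 𝔖 n
word o {D} F = cast-id (sym (↔⇒≡ bij)) ∘ₚ bij
  where bij = F ↔-∘ enumerate o D

w-TL w-RB w-BR : {D : Diagram w h} → Filling D n → 𝔖 n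
w-TL = word (columnByColumn forwards backwards)
w-RB = word (rowByRow backwards forwards)
w-BR = word (columnByColumn backwards forwards)

IsST : {D : Diagram w h} → Filling D n → Set
IsST {D = D} F = ∀ (b c : Cell D) → proj₁ b ≤B proj₁ c → Inverse.to F b Fin.≤ Inverse.to F c

ST : Diagram w h → ℕ → Set
ST D n = Σ[ F ∈ Filling D n ] IsST F

infix 4 _≈ST_ _⊴_

_≈ST_ _⊴_ : {D : Diagram w h} → Rel (ST D n) 0ℓ
(F , _) ≈ST (G , _) = ∀ b → Inverse.to F b ≡ Inverse.to G b
(F , _) ⊴   (G , _) = w-TL F ⪯L w-TL G

record Composition (n : ℕ) : Set where
  field
    parts    : List ℕ
    positive : All (0 <_) parts
    sum≡n    : sum parts ≡ n

open Composition public

-- The index i : Fin (pred n) stands for toℕ i + 1 ∈ [n-1].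
set : ∀ n → List ℕ → Pred (Fin (pred n)) 0ℓ
set n α i = ∃[ k ] 0 < k × k < length α × sum (take k α) ≡ suc (toℕ i)

sort↓ : List ℕ → List ℕ
sort↓ = Sort.sort (Flip.decTotalOrder ≤-decTotalOrder)

-- λ′ⱼ₊₁ = #{ i ∣ λᵢ > j } for 0 ≤ j < λ₁ = max λ.
conjugate : List ℕ → List ℕ
conjugate λs = List.map (λ j → length (filter (j <?_) λs)) (upTo (max 0 λs))

width : Composition n → ℕ
width α = max 0 (parts α)

rows : Composition n → ℕ
rows α = length (parts α)

tcd : (α : Composition n) → Diagram (width α) (rows α)
tcd α (j , i) = toℕ j <ᵇ lookup (parts α) i

record IsSET (α : Composition n) (F : Filling (tcd α) n) : Set where
  field
    rows-increase : ∀ {j j′ i} (p : T (tcd α (j , i))) (q : T (tcd α (j′ , i))) →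
      j Fin.< j′ → Inverse.to F ((j , i) , p) Fin.< Inverse.to F ((j′ , i) , q)
    columns-increase : ∀ {j i i′} (p : T (tcd α (j , i))) (q : T (tcd α (j , i′))) →
      i Fin.< i′ → Inverse.to F ((j , i) , p) Fin.< Inverse.to F ((j , i′) , q)

SET : Composition n → Set
SET {n} α = Σ[ F ∈ Filling (tcd α) n ] IsSET α F

length-filter-map : ∀ {a b} {A : Set a} {B : Set b} (D : B → Bool) (f : A → B) xs →
  length (filter (T? ∘ D) (List.map f xs)) ≡ length (filter (T? ∘ D ∘ f) xs)
length-filter-map D f [] = refl
length-filter-map D f (x ∷ xs) with does (T? (D (f x)))
... | Bool.true  = cong suc (length-filter-map D f xs)
... | Bool.false = length-filter-map D f xs

length-initial : ∀ {a m} → a ≤ m →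
  length (filter (T? ∘ λ x → toℕ x <ᵇ a) (allFin m)) ≡ a
length-initial {m = zero}  z≤n = refl
length-initial {m = suc m} z≤n = begin
  length (filter (T? ∘ λ x → toℕ x <ᵇ 0) (tabulate {n = m} suc))
    ≡⟨ cong (length ∘ filter (T? ∘ λ x → toℕ x <ᵇ 0)) (sym (map-tabulate {n = m} (λ x → x) suc)) ⟩
  length (filter (T? ∘ λ x → toℕ x <ᵇ 0) (List.map suc (allFin m)))
    ≡⟨ length-filter-map (λ x → toℕ x <ᵇ 0) suc (allFin m) ⟩
  length (filter (T? ∘ λ x → toℕ x <ᵇ 0) (allFin m))
    ≡⟨ length-initial {m = m} z≤n ⟩
  0 ∎
  where open ≡-Reasoning
length-initial {suc a} {suc m} (s≤s a≤m) = cong suc (begin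
  length (filter (T? ∘ λ x → toℕ x <ᵇ suc a) (tabulate {n = m} suc))
    ≡⟨ cong (length ∘ filter (T? ∘ λ x → toℕ x <ᵇ suc a)) (sym (map-tabulate {n = m} (λ x → x) suc)) ⟩
  length (filter (T? ∘ λ x → toℕ x <ᵇ suc a) (List.map suc (allFin m)))
    ≡⟨ length-filter-map (λ x → toℕ x <ᵇ suc a) suc (allFin m) ⟩
  length (filter (T? ∘ λ x → toℕ x <ᵇ a) (allFin m))
    ≡⟨ length-initial a≤m ⟩
  a ∎)
  where open ≡-Reasoning

length-tcd : (α : Composition n) → length (listed (rowByRow forwards forwards) (tcd α)) ≡ n
length-tcd α = trans (go (allFin (rows α))) (trans (cong sum lookup-allFin) (sum≡n α))
  where
  open ≡-Reasoning
  g = lookup (parts α)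
  row = λ y x → x , y
  xs = allFin (width α)
  lookup-allFin : List.map g (allFin (rows α)) ≡ parts α
  lookup-allFin = trans (map-tabulate (λ x → x) g) (tabulate-lookup (parts α))
  go : ∀ ys → length (filter (T? ∘ tcd α) (cartesianProductWith row ys xs)) ≡ sum (List.map g ys)
  go []       = refl
  go (y ∷ ys) = begin
    length (filter (T? ∘ tcd α) (List.map (row y) xs ++ cartesianProductWith row ys xs))
      ≡⟨ cong length (filter-++ (T? ∘ tcd α) (List.map (row y) xs) _) ⟩
    length (filter (T? ∘ tcd α) (List.map (row y) xs) ++ _)
      ≡⟨ length-++ (filter (T? ∘ tcd α) (List.map (row y) xs)) ⟩
    length (filter (T? ∘ tcd α) (List.map (row y) xs)) + _
      ≡⟨ cong₂ _+_
           (trans (length-filter-map (tcd α) (row y) xs)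
                  (length-initial (All.lookup (xs≤max 0 (parts α)) (∈-lookup y))))
           (go ys) ⟩
    g y + sum (List.map g ys) ∎

length-tcd′ : (α : Composition n) (o : ReadingOrder (width α) (rows α)) → length (listed o (tcd α)) ≡ n
length-tcd′ α o = trans
  (↔⇒≡ (↔-sym (enumerate (rowByRow forwards forwards) (tcd α)) ↔-∘ enumerate o (tcd α)))
  (length-tcd α)

-- The filling of tcd(α) by 1,…,n in the given order.
fill : (α : Composition n) → ReadingOrder (width α) (rows α) → Filling (tcd α) n
fill α o = cast-id (length-tcd′ α o) ↔-∘ ↔-sym (enumerate o (tcd α))

𝖳 𝖳′ : (α : Composition n) → Filling (tcd α) n
𝖳 α  = fill α (rowByRow forwards forwards)
𝖳′ α = fill α (columnByColumn forwards forwards)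

-- { w_RB(T) : T an SET of shape α }
w-RB[SET] : Composition n → Pred (𝔖 n) 0ℓ
w-RB[SET] α σ = Σ[ T ∈ SET α ] σ ≈ w-RB (proj₁ T)

C-X : Composition n → Pred (LeftInterval n) 0ℓ
C-X α = Class (w-RB[SET] α)

𝓔 : (α : Composition n) → Diagram (rows α) (width α)
𝓔 α = tcd α ᵀ

{-# OPTIONS --safe #-}

-- A reading word of a SET F is F ∘ ω⁻¹ for a bijection ω from the cells of tcd(α) to [n].  Call
-- ω admissible (SouthEast) if it decreases to the right along rows and increases up the columns.
-- Inversions and descents of F ∘ ω⁻¹ are governed by the relative position of cells only: for
-- two cells related in the south-east direction every admissible ω agrees with w_RB, and for two
-- cells related in the north-east direction F is the same for all SETs.  Hence the words of
-- all SETs read by ω form the left interval from 𝖳 ∘ ω⁻¹ to 𝖳′ ∘ ω⁻¹, which is ∼D-equivalent to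
-- the one for w_RB.  Conversely, a descent preserving isomorphism is a right translation, so every
-- member of the class is given by some ω, and comparing the descents of 𝖳 ∘ ω⁻¹ and 𝖳′ ∘ ω⁻¹
-- with those of the w_RB-words shows that ω is admissible.  After transposition and reflection the
-- admissible ω are the elements of ST(𝓔ˣ), and w_TL(ω) = ω ∘ 𝖳⁻¹ is the inverse of the
-- bottom element 𝖳 ∘ ω⁻¹, which turns ⪯R on the class into ⪯L on words w_TL.

module Submission where

open import Data.Nat.Properties
  using (≤-refl; ≤-reflexive; ≤-trans; ≤-antisym; <-trans; ≤-<-trans; <-irrefl; <-asym; <⇒≤;
         <⇒≱; ≰⇒>; _<?_; ≮⇒≥; n<1+n; n≤1+n; suc-injective; +-suc; +-identityʳ; m≤m+n; m≤n⇒m<n∨m≡n;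
         ∸-monoʳ-<; <ᵇ⇒<; <⇒<ᵇ; ≤-decTotalOrder; m<m+n; +-0-commutativeMonoid; module ≤-Reasoning)
open import Algebra.Properties.CommutativeMonoid.Sum +-0-commutativeMonoid
  using (sum-cong-≗; sum-permute) renaming (sum to ∑)
open import Data.Bool.Base using (T)
open import Data.Bool.Properties using (T?)
open import Data.Fin.Base as Fin using (Fin; zero; suc; toℕ; inject₁; opposite)
open import Data.Fin.Induction using (<-weakInduction)
open import Data.Fin.Permutation as Perm
  using (_⟨$⟩ʳ_; _⟨$⟩ˡ_; _≈_; inverseˡ; inverseʳ; cast-id; ↔⇒≡)
open import Data.Fin.Properties
  using (_≟_; <-cmp; any?; ≤-total; toℕ-inject₁; inject₁-injective; toℕ-injective; toℕ-cast;
         toℕ<n; toℕ-fromℕ; opposite-prop; opposite-involutive)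
  renaming (_<?_ to _<F?_; ≤∧≢⇒< to ≤∧≢⇒<F)
open import Data.List.Base as List
  using (List; []; _∷_; length; tabulate; reverse; _∷ʳ_; _++_; take; drop; filter; lookup;
         allFin; cartesianProductWith; upTo; applyUpTo; applyDownFrom)
open import Data.List.Extrema.Nat using (max; xs≤max; max-mono-⊆)
open import Data.List.Membership.Propositional.Properties using (∈-lookup)
open import Data.List.Properties
  using (length-reverse; unfold-reverse; map-upTo; reverse-applyUpTo; map-tabulate;
         tabulate-lookup; tabulate-cong; filter-≐; take++drop≡id; take-map; filter-++; length-++;
         length-map; length-tabulate; cartesianProductWith-distribʳ-++; map-cong)
open import Data.List.Relation.Binary.Permutation.Propositional using (_↭_; ↭-sym)
open import Data.List.Relation.Binary.Permutation.Propositional.Properties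
  using (∈-resp-↭; filter-↭; ↭-length)
open import Data.List.Relation.Unary.All as All using (All; []; _∷_)
open import Data.List.Relation.Unary.AllPairs as AllPairs using (AllPairs; []; _∷_)
open import Data.Nat.Base using (ℕ; zero; suc; _+_; _<_; _≤_; _<ᵇ_; z≤n; s≤s; s≤s⁻¹; NonZero)
open import Data.Nat.ListAction using (sum)
open import Data.Product.Base using (∃; ∃-syntax; Σ-syntax; _×_; _,_; proj₁; proj₂; swap)
open import Data.Sum.Base as Sum using (_⊎_; inj₁; inj₂; [_,_]′)
open import Data.Unit.Base using (tt)
open import Function.Base using (_∘_; id; _on_; flip)
open import Function.Bundles using (_↔_; Injection; Inverse; mk↔ₛ′)
open import Function.Construct.Composition using (_↔-∘_)
open import Function.Construct.Symmetry using (↔-sym)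
open import Function.Properties.Inverse using (↔⇒↣)
open import Level using (0ℓ)
open import Relation.Binary.Construct.Closure.ReflexiveTransitive using (ε; _◅_; _◅◅_; gmap)
open import Relation.Binary.Core using (Rel)
open import Relation.Binary.Definitions using (Transitive; tri<; tri≈; tri>)
open import Relation.Binary.Morphism.Structures using (IsOrderIsomorphism)
open import Relation.Binary.PropositionalEquality
  using (_≡_; _≢_; refl; sym; trans; cong; cong₂; subst; subst₂; module ≡-Reasoning)
open import Relation.Nullary using (¬_; Dec; yes; no; contradiction)
open import Relation.Nullary.Decidable using (dec-true; dec-false; _×-dec_)
open import Relation.Unary using (Pred; _∈_; ∁; Decidable; _≐_)
open import Relation.Unary.Properties using (≐-sym; ≐-trans)
import Data.Fin.Permutation.Components as PC
import Data.Fin.Properties as Finₚ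
import Data.List.Relation.Unary.All.Properties as Allₚ
import Data.List.Relation.Unary.AllPairs.Properties as AllPairsₚ
import Data.List.Sort as Sort
import Relation.Binary.Construct.Flip.EqAndOrd as Flip
open import Defs

private
  variable
    n w h a b : ℕ
    X Y Z : Set

-- Neighbouring values and simple transpositions

perm-injective : (π : 𝔖 n) {i j : Fin n} → π ⟨$⟩ʳ i ≡ π ⟨$⟩ʳ j → i ≡ j
perm-injective π = Injection.injective (↔⇒↣ π)

toℕ-suc : (i : Fin n) → toℕ (suc i) ≡ suc (toℕ (inject₁ i))
toℕ-suc i = cong suc (sym (toℕ-inject₁ i))

i<1+i : (i : Fin n) → inject₁ i Fin.< suc i
i<1+i i = ≤-reflexive (sym (toℕ-suc i))

i≢1+i : (i : Fin n) → inject₁ i ≢ suc i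
i≢1+i i eq = <-irrefl (cong toℕ eq) (i<1+i i)

1+i≤ : (i : Fin n) {k : Fin (suc n)} → inject₁ i Fin.< k → suc i Fin.≤ k
1+i≤ i {k} = subst (_≤ toℕ k) (sym (toℕ-suc i))

≤i : (i : Fin n) {k : Fin (suc n)} → k Fin.< suc i → k Fin.≤ inject₁ i
≤i i {k} p = s≤s⁻¹ (subst (suc (toℕ k) ≤_) (toℕ-suc i) p)

-- Only the steps between `u` and `v` are assumed, so that comparisons along one row or column of a
-- tableau can be obtained from its consecutive entries.
chain : ∀ {ℓ} {R : Rel (Fin (suc n)) ℓ} → Transitive R → ∀ {u} v → u Fin.< v →
        (∀ i → u Fin.≤ inject₁ i → suc i Fin.≤ v → R (inject₁ i) (suc i)) → R u v
chain {n} {R = R} R-trans {u} = <-weakInduction Q (λ ()) step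
  where
  Q : Fin (suc n) → Set _
  Q v = u Fin.< v → (∀ i → u Fin.≤ inject₁ i → suc i Fin.≤ v → R (inject₁ i) (suc i)) → R u v
  step : ∀ i → Q (inject₁ i) → Q (suc i)
  step i Qi u<1+i rs with u ≟ inject₁ i
  ... | yes refl = rs i ≤-refl ≤-refl
  ... | no u≢i   = R-trans (Qi u<i λ j p q → rs j p (≤-trans q (<⇒≤ (i<1+i i))))
                           (rs i (<⇒≤ u<i) ≤-refl)
    where
    u<i : u Fin.< inject₁ i
    u<i = ≤∧≢⇒<F (≤i i u<1+i) u≢i

transpose-left : (i j : Fin n) → PC.transpose i j i ≡ j
transpose-left i j rewrite dec-true (i ≟ i) refl = refl

transpose-right : (i j : Fin n) → PC.transpose i j j ≡ i
transpose-right i j with j ≟ i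
... | yes refl = refl
... | no _ rewrite dec-true (j ≟ j) refl = refl

transpose-other : {i j k : Fin n} → k ≢ i → k ≢ j → PC.transpose i j k ≡ k
transpose-other {i = i} {j} {k} k≢i k≢j
  rewrite dec-false (k ≟ i) k≢i | dec-false (k ≟ j) k≢j = refl

s-lo : (i : Fin n) → s i ⟨$⟩ʳ inject₁ i ≡ suc i
s-lo i = transpose-left (inject₁ i) (suc i)

s-hi : (i : Fin n) → s i ⟨$⟩ʳ suc i ≡ inject₁ i
s-hi i = transpose-right (inject₁ i) (suc i)

s-other : (i : Fin n) {k : Fin (suc n)} → k ≢ inject₁ i → k ≢ suc i → s i ⟨$⟩ʳ k ≡ k
s-other i = transpose-other

data Position (i : Fin n) : Fin (suc n) → Set where
  low   : Position i (inject₁ i)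
  high  : Position i (suc i)
  other : ∀ {k} → k ≢ inject₁ i → k ≢ suc i → Position i k

position : (i : Fin n) (k : Fin (suc n)) → Position i k
position i k with k ≟ inject₁ i | k ≟ suc i
... | yes refl | _        = low
... | no _     | yes refl = high
... | no p     | no q     = other p q

s-involutive : (i : Fin n) (k : Fin (suc n)) → s i ⟨$⟩ʳ (s i ⟨$⟩ʳ k) ≡ k
s-involutive i k with position i k
... | low       = trans (cong (s i ⟨$⟩ʳ_) (s-lo i)) (s-hi i)
... | high      = trans (cong (s i ⟨$⟩ʳ_) (s-hi i)) (s-lo i)
... | other p q = trans (cong (s i ⟨$⟩ʳ_) (s-other i p q)) (s-other i p q)

s-inverse : (i : Fin n) (k : Fin (suc n)) → s i ⟨$⟩ˡ k ≡ s i ⟨$⟩ʳ k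
s-inverse i k = trans (cong (s i ⟨$⟩ˡ_) (sym (s-involutive i k))) (inverseˡ (s i))

-- Since `inject₁ i` and `suc i` are neighbours, any third value lies on the same side of both; only
-- the excluded pair can change its order.
s-mono : (i : Fin n) {u v : Fin (suc n)} → u Fin.< v → ¬ (u ≡ inject₁ i × v ≡ suc i) →
         s i ⟨$⟩ʳ u Fin.< s i ⟨$⟩ʳ v
s-mono i {u} {v} u<v not with position i u | position i v
... | low  | low  = contradiction u<v (<-irrefl refl)
... | low  | high = contradiction (refl , refl) not
... | low  | other p q rewrite s-lo i | s-other i p q = ≤∧≢⇒<F (1+i≤ i u<v) (q ∘ sym)
... | high | low  = contradiction u<v (<-asym (i<1+i i))
... | high | high = contradiction u<v (<-irrefl refl)
... | high | other p q rewrite s-hi i | s-other i p q = <-trans (i<1+i i) u<v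
... | other p q | low  rewrite s-lo i | s-other i p q = <-trans u<v (i<1+i i)
... | other p q | high rewrite s-hi i | s-other i p q = ≤∧≢⇒<F (≤i i u<v) p
... | other p q | other p′ q′ rewrite s-other i p q | s-other i p′ q′ = u<v

-- Finite sums

∑-zero : {f : Fin n → ℕ} → (∀ i → f i ≡ 0) → ∑ f ≡ 0
∑-zero {zero}  eq = refl
∑-zero {suc n} eq = cong₂ _+_ (eq zero) (∑-zero (eq ∘ suc))

-- Applied to the outer and then to the inner sum of `invCount`, this shows that a single new
-- inversion adds one.
∑-bump : {f g : Fin n → ℕ} (p : Fin n) → (∀ i → i ≢ p → f i ≡ g i) → f p ≡ suc (g p) →
         ∑ f ≡ suc (∑ g)
∑-bump zero off at = cong₂ _+_ at (sum-cong-≗ λ i → off (suc i) λ ())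
∑-bump {g = g} (suc p) off at = trans
  (cong₂ _+_ (off zero λ ()) (∑-bump p (λ i i≢p → off (suc i) λ { refl → i≢p refl }) at))
  (+-suc (g zero) _)

⌊_⌋ : {A : Set} → Dec A → ℕ
⌊ yes _ ⌋ = 1
⌊ no _ ⌋  = 0

⌊⌋-cong : {A B : Set} (A? : Dec A) (B? : Dec B) → (A → B) → (B → A) → ⌊ A? ⌋ ≡ ⌊ B? ⌋
⌊⌋-cong (yes a) (yes b) f g = refl
⌊⌋-cong (yes a) (no ¬b) f g = contradiction (f a) ¬b
⌊⌋-cong (no ¬a) (yes b) f g = contradiction (g b) ¬a
⌊⌋-cong (no ¬a) (no ¬b) f g = refl

⌊⌋-yes : {A : Set} (A? : Dec A) → A → ⌊ A? ⌋ ≡ 1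
⌊⌋-yes (yes _) a = refl
⌊⌋-yes (no ¬a) a = contradiction a ¬a

⌊⌋-no : {A : Set} (A? : Dec A) → ¬ A → ⌊ A? ⌋ ≡ 0
⌊⌋-no (yes a) ¬a = contradiction a ¬a
⌊⌋-no (no _)  ¬a = refl

-- Inversions and Coxeter length

Inversion : 𝔖 n → Rel (Fin n) _
Inversion σ a b = a Fin.< b × σ ⟨$⟩ʳ b Fin.< σ ⟨$⟩ʳ a

inversion? : (σ : 𝔖 n) (a b : Fin n) → Dec (Inversion σ a b)
inversion? σ a b = (a <F? b) ×-dec (σ ⟨$⟩ʳ b <F? σ ⟨$⟩ʳ a)

invCount : 𝔖 n → ℕ
invCount σ = ∑ (λ a → ∑ (λ b → ⌊ inversion? σ a b ⌋))

invCount-cong : {σ τ : 𝔖 n} → σ ≈ τ → invCount σ ≡ invCount τ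
invCount-cong {σ = σ} {τ} σ≈τ = sum-cong-≗ λ a → sum-cong-≗ λ b →
  ⌊⌋-cong (inversion? σ a b) (inversion? τ a b)
    (λ (p , q) → p , subst₂ Fin._<_ (σ≈τ b) (σ≈τ a) q)
    (λ (p , q) → p , subst₂ Fin._<_ (sym (σ≈τ b)) (sym (σ≈τ a)) q)

invCount-id : invCount {n} Perm.id ≡ 0
invCount-id {n} = ∑-zero {n} λ a → ∑-zero {n} λ b → ⌊⌋-no (inversion? Perm.id a b) λ (p , q) → <-asym p q

-- These compare the positions of two consecutive values in the one-line word. `Des-L⇒descent` and
-- `descent⇒Des-L` match `Descent` with the definition of `Des-L` by Coxeter length.
Ascent Descent : 𝔖 (suc n) → Fin n → Set
Ascent  σ i = σ ⟨$⟩ˡ inject₁ i Fin.< σ ⟨$⟩ˡ suc i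
Descent σ i = σ ⟨$⟩ˡ suc i Fin.< σ ⟨$⟩ˡ inject₁ i

ascent⊎descent : (σ : 𝔖 (suc n)) (i : Fin n) → Ascent σ i ⊎ Descent σ i
ascent⊎descent σ i with <-cmp (σ ⟨$⟩ˡ inject₁ i) (σ ⟨$⟩ˡ suc i)
... | tri< p _ _ = inj₁ p
... | tri≈ _ p _ = contradiction (perm-injective (Perm.flip σ) p) (i≢1+i i)
... | tri> _ _ p = inj₂ p

≢⇒<⊎> : {a b : Fin n} → a ≢ b → a Fin.< b ⊎ b Fin.< a
≢⇒<⊎> {a = a} {b} a≢b with <-cmp a b
... | tri< p _ _ = inj₁ p
... | tri≈ _ p _ = contradiction p a≢b
... | tri> _ _ p = inj₂ p

-- Only the pair of positions holding the values inject₁ i and suc i changes its status.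
module _ (σ : 𝔖 (suc n)) (i : Fin n) (asc : Ascent σ i) where

  private
    p = σ ⟨$⟩ˡ inject₁ i
    q = σ ⟨$⟩ˡ suc i

    position-lo : ∀ {a} → σ ⟨$⟩ʳ a ≡ inject₁ i → a ≡ p
    position-lo eq = trans (sym (inverseˡ σ)) (cong (σ ⟨$⟩ˡ_) eq)

    position-hi : ∀ {a} → σ ⟨$⟩ʳ a ≡ suc i → a ≡ q
    position-hi eq = trans (sym (inverseˡ σ)) (cong (σ ⟨$⟩ˡ_) eq)

  inversion-s⁺ : ∀ {a b} → Inversion σ a b → Inversion (s i · σ) a b
  inversion-s⁺ {a} {b} (a<b , σb<σa) = a<b , s-mono i σb<σa λ (σb≡ , σa≡) →
    <-asym asc (subst₂ Fin._<_ (position-hi σa≡) (position-lo σb≡) a<b)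

  inversion-s⁻ : ∀ {a b} → ¬ (a ≡ p × b ≡ q) → Inversion (s i · σ) a b → Inversion σ a b
  inversion-s⁻ {a} {b} not (a<b , r) with ≢⇒<⊎> {a = σ ⟨$⟩ʳ a} {σ ⟨$⟩ʳ b}
                                        (λ eq → <-irrefl (cong toℕ (perm-injective σ eq)) a<b)
  ... | inj₂ σb<σa = a<b , σb<σa
  ... | inj₁ σa<σb = contradiction r (<-asym (s-mono i σa<σb
                       λ (σa≡ , σb≡) → not (position-lo σa≡ , position-hi σb≡)))

  inversion-new : Inversion (s i · σ) p q
  inversion-new = asc , subst₂ Fin._<_
    (sym (trans (cong (s i ⟨$⟩ʳ_) (inverseʳ σ)) (s-hi i)))
    (sym (trans (cong (s i ⟨$⟩ʳ_) (inverseʳ σ)) (s-lo i))) (i<1+i i)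

  invCount-ascent : invCount (s i · σ) ≡ suc (invCount σ)
  invCount-ascent = ∑-bump p
    (λ a a≢p → sum-cong-≗ λ b → unchanged a b (a≢p ∘ proj₁))
    (∑-bump q (λ b b≢q → unchanged p b (b≢q ∘ proj₂))
      (trans (⌊⌋-yes (inversion? (s i · σ) p q) inversion-new)
             (cong suc (sym (⌊⌋-no (inversion? σ p q) λ (_ , r) →
               <-asym (i<1+i i) (subst₂ Fin._<_ (inverseʳ σ) (inverseʳ σ) r))))))
    where
    unchanged : ∀ a b → ¬ (a ≡ p × b ≡ q) → ⌊ inversion? (s i · σ) a b ⌋ ≡ ⌊ inversion? σ a b ⌋
    unchanged a b not = ⌊⌋-cong (inversion? (s i · σ) a b) (inversion? σ a b)
                          (inversion-s⁻ not) inversion-s⁺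

descent⇒ascent-s : (σ : 𝔖 (suc n)) {i : Fin n} → Descent σ i → Ascent (s i · σ) i
descent⇒ascent-s σ {i} = subst₂ Fin._<_
  (cong (σ ⟨$⟩ˡ_) (sym (trans (s-inverse i (inject₁ i)) (s-lo i))))
  (cong (σ ⟨$⟩ˡ_) (sym (trans (s-inverse i (suc i)) (s-hi i))))

ascent⇒descent-s : (σ : 𝔖 (suc n)) {i : Fin n} → Ascent σ i → Descent (s i · σ) i
ascent⇒descent-s σ {i} = subst₂ Fin._<_
  (cong (σ ⟨$⟩ˡ_) (sym (trans (s-inverse i (suc i)) (s-hi i))))
  (cong (σ ⟨$⟩ˡ_) (sym (trans (s-inverse i (inject₁ i)) (s-lo i))))

invCount-descent : (σ : 𝔖 (suc n)) (i : Fin n) → Descent σ i →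
                   invCount σ ≡ suc (invCount (s i · σ))
invCount-descent σ i des = trans
  (invCount-cong {σ = σ} {s i · (s i · σ)} λ k → sym (s-involutive i (σ ⟨$⟩ʳ k)))
  (invCount-ascent (s i · σ) i (descent⇒ascent-s σ des))

invCount-s : (σ : 𝔖 (suc n)) (i : Fin n) → invCount (s i · σ) ≤ suc (invCount σ)
invCount-s σ i with ascent⊎descent σ i
... | inj₁ asc = ≤-reflexive (invCount-ascent σ i asc)
... | inj₂ des = ≤-trans (n≤1+n _) (≤-trans (≤-reflexive (sym (invCount-descent σ i des))) (n≤1+n _))

invCount-product : (is : List (Fin n)) → invCount (product {suc n} is) ≤ length is
invCount-product {n} [] = ≤-reflexive (invCount-id {suc n})
invCount-product (i ∷ is) = ≤-trans (invCount-s (product is) i) (s≤s (invCount-product is))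

StrictlyMonotone : 𝔖 n → Set
StrictlyMonotone π = ∀ {u v} → u Fin.< v → π ⟨$⟩ʳ u Fin.< π ⟨$⟩ʳ v

monotone-inflationary : (π : 𝔖 n) → StrictlyMonotone π → ∀ k → k Fin.≤ π ⟨$⟩ʳ k
monotone-inflationary {suc n} π mono = <-weakInduction (λ k → k Fin.≤ π ⟨$⟩ʳ k) z≤n λ i i≤πi →
  ≤-<-trans (≤-trans (≤-reflexive (sym (toℕ-inject₁ i))) i≤πi) (mono (i<1+i i))

flip-monotone : (π : 𝔖 n) → StrictlyMonotone π → StrictlyMonotone (Perm.flip π)
flip-monotone π mono {u} {v} u<v
  with ≢⇒<⊎> {a = π ⟨$⟩ˡ u} {π ⟨$⟩ˡ v} (λ eq → <-irrefl (cong toℕ (perm-injective (Perm.flip π) eq)) u<v)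
... | inj₁ p = p
... | inj₂ p = contradiction (subst₂ Fin._<_ (inverseʳ π) (inverseʳ π) (mono p)) (<-asym u<v)

-- An increasing bijection moves no element down; the same holds for its inverse, so nothing moves.
monotone⇒id : (π : 𝔖 n) → StrictlyMonotone π → π ≈ Perm.id
monotone⇒id π mono k = toℕ-injective (≤-antisym
  (subst (λ z → π ⟨$⟩ʳ k Fin.≤ z) (inverseˡ π)
    (monotone-inflationary (Perm.flip π) (flip-monotone π mono) (π ⟨$⟩ʳ k)))
  (monotone-inflationary π mono k))

-- Without descents the values occur in their natural order from left to right, so the inverse is
-- increasing and trivial. This dichotomy drives the inductions on `invCount`: either the identity
-- is reached or a descent can be removed.
descent⊎id : (σ : 𝔖 (suc n)) → ∃ (Descent σ) ⊎ σ ≈ Perm.id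
descent⊎id σ with any? (λ i → σ ⟨$⟩ˡ suc i <F? σ ⟨$⟩ˡ inject₁ i)
... | yes des = inj₁ des
... | no ¬des = inj₂ λ k → trans (cong (σ ⟨$⟩ʳ_) (sym (flip≈id k))) (inverseʳ σ)
  where
  asc : ∀ i → Ascent σ i
  asc i = [ id , (λ des → contradiction (i , des) ¬des) ]′ (ascent⊎descent σ i)
  flip≈id : Perm.flip σ ≈ Perm.id
  flip≈id = monotone⇒id (Perm.flip σ) λ {u} {v} u<v →
    chain {R = λ u v → σ ⟨$⟩ˡ u Fin.< σ ⟨$⟩ˡ v} <-trans v u<v (λ i _ _ → asc i)

s·-cancel : (i : Fin n) {σ τ : 𝔖 (suc n)} → τ ≈ s i · σ → s i · τ ≈ σ
s·-cancel i {σ} eq k = trans (cong (s i ⟨$⟩ʳ_) (eq k)) (s-involutive i (σ ⟨$⟩ʳ k))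

reduced-word : ∀ m (σ : 𝔖 (suc n)) → invCount σ ≡ m → ∃[ is ] length is ≡ m × product is ≈ σ
reduced-word m σ eq with descent⊎id σ
reduced-word {n} m σ eq | inj₂ σ≈id =
  [] , trans (sym (invCount-id {suc n})) (trans (sym (invCount-cong {σ = σ} {Perm.id} σ≈id)) eq) , λ k → sym (σ≈id k)
reduced-word zero σ eq | inj₁ (i , des) with () ← trans (sym eq) (invCount-descent σ i des)
reduced-word (suc m) σ eq | inj₁ (i , des)
  with is , refl , prod ← reduced-word m (s i · σ) (suc-injective (trans (sym (invCount-descent σ i des)) eq))
  = i ∷ is , refl , s·-cancel i {σ = σ} {product is} prod

-- `reduced-word` spends one letter per inversion, while by `invCount-product` no word creates more
-- inversions than it has letters.
isLength-invCount : (σ : 𝔖 (suc n)) → IsLength σ (invCount σ)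
isLength-invCount σ = reduced-word _ σ refl , λ is prod →
  ≤-trans (≤-reflexive (sym (invCount-cong {σ = product is} {σ} prod))) (invCount-product is)

isLength⇒≡ : (σ : 𝔖 (suc n)) {k : ℕ} → IsLength σ k → k ≡ invCount σ
isLength⇒≡ σ ((is , refl , prod) , minimal) with (js , len , prod′) , minimal′ ← isLength-invCount σ =
  ≤-antisym (≤-trans (minimal js prod′) (≤-reflexive len)) (minimal′ is prod)

<ℓ⇒< : {σ τ : 𝔖 (suc n)} → σ <ℓ τ → invCount σ < invCount τ
<ℓ⇒< {σ = σ} {τ} (k , m , σk , τm , k<m) = subst₂ _<_ (isLength⇒≡ σ σk) (isLength⇒≡ τ τm) k<m

<⇒<ℓ : {σ τ : 𝔖 (suc n)} → invCount σ < invCount τ → σ <ℓ τ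
<⇒<ℓ {σ = σ} {τ} lt = _ , _ , isLength-invCount σ , isLength-invCount τ , lt

Des-L⇒descent : (σ : 𝔖 (suc n)) {i : Fin n} → i ∈ Des-L σ → Descent σ i
Des-L⇒descent σ {i} d with ascent⊎descent σ i
... | inj₂ des = des
... | inj₁ asc = contradiction (<ℓ⇒< {σ = s i · σ} {σ} d)
                   (<-asym (subst (invCount σ <_) (sym (invCount-ascent σ i asc)) (n<1+n _)))

descent⇒Des-L : (σ : 𝔖 (suc n)) {i : Fin n} → Descent σ i → i ∈ Des-L σ
descent⇒Des-L σ {i} des = <⇒<ℓ {σ = s i · σ} {σ}
  (subst (invCount (s i · σ) <_) (sym (invCount-descent σ i des)) (n<1+n _))

¬Des-L⇒ascent : (σ : 𝔖 (suc n)) {i : Fin n} → ¬ Des-L σ i → Ascent σ i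
¬Des-L⇒ascent σ {i} ¬d = [ id , (λ des → contradiction (descent⇒Des-L σ des) ¬d) ]′ (ascent⊎descent σ i)

ascent⇒¬Des-L : (σ : 𝔖 (suc n)) {i : Fin n} → Ascent σ i → ¬ Des-L σ i
ascent⇒¬Des-L σ asc d = <-asym asc (Des-L⇒descent σ d)

-- Weak orders

infix 4 _⊑_
-- Inversions are recorded by positions: left multiplication exchanges values, so the old pairs
-- persist along the left weak order.
_⊑_ : Rel (𝔖 n) _
σ ⊑ τ = ∀ {a b} → Inversion σ a b → Inversion τ a b

≈⇒⊑ : {σ τ : 𝔖 n} → σ ≈ τ → σ ⊑ τ
≈⇒⊑ eq {a} {b} (p , q) = p , subst₂ Fin._<_ (eq b) (eq a) q

⪯L⇒⊑ : {σ τ : 𝔖 (suc n)} → σ ⪯L τ → σ ⊑ τ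
⪯L⇒⊑ ε iv = iv
⪯L⇒⊑ {σ = σ} (_◅_ {j = ρ} (inj₁ eq) rest) iv = ⪯L⇒⊑ rest (≈⇒⊑ {σ = σ} {ρ} eq iv)
⪯L⇒⊑ {σ = σ} (_◅_ {j = ρ} (inj₂ (i , ¬d , eq)) rest) iv =
  ⪯L⇒⊑ rest (≈⇒⊑ {σ = s i · σ} {ρ} (sym ∘ eq) (inversion-s⁺ σ i (¬Des-L⇒ascent σ ¬d) iv))

-- Induction on the number of inversions of σ τ⁻¹: a left descent i of it is an ascent of σ
-- whose new inversion already is one of τ.
⊑⇒⪯L : {σ τ : 𝔖 (suc n)} → σ ⊑ τ → σ ⪯L τ
⊑⇒⪯L {n} {σ} {τ} = go _ σ refl
  where
  go : ∀ m σ → invCount (σ · Perm.flip τ) ≡ m → σ ⊑ τ → σ ⪯L τ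
  go m σ eq σ⊑τ with descent⊎id (σ · Perm.flip τ)
  ... | inj₂ στ⁻≈id = inj₁ (λ k → trans (cong (σ ⟨$⟩ʳ_) (sym (inverseˡ τ))) (στ⁻≈id (τ ⟨$⟩ʳ k))) ◅ ε
  go zero σ eq σ⊑τ | inj₁ (i , des) with () ← trans (sym eq) (invCount-descent (σ · Perm.flip τ) i des)
  go (suc m) σ eq σ⊑τ | inj₁ (i , des) =
    inj₂ (i , ascent⇒¬Des-L σ asc , λ _ → refl) ◅
    go m (s i · σ) (suc-injective (trans (sym (invCount-descent (σ · Perm.flip τ) i des)) eq)) siσ⊑τ
    where
    asc : Ascent σ i
    asc with ascent⊎descent σ i
    ... | inj₁ asc = asc
    ... | inj₂ des′ = contradiction des (<-asym (proj₂ (σ⊑τ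
            (des′ , subst₂ Fin._<_ (sym (inverseʳ σ)) (sym (inverseʳ σ)) (i<1+i i)))))
    siσ⊑τ : s i · σ ⊑ τ
    siσ⊑τ {a} {b} iv with a ≟ σ ⟨$⟩ˡ inject₁ i | b ≟ σ ⟨$⟩ˡ suc i
    ... | yes refl | yes refl = asc , des
    ... | no a≢ | _ = σ⊑τ (inversion-s⁻ σ i asc (a≢ ∘ proj₁) iv)
    ... | _ | no b≢ = σ⊑τ (inversion-s⁻ σ i asc (b≢ ∘ proj₂) iv)

-- The closure also contains `≈`-steps. Counting inversions separates chains made of these alone
-- from chains with a genuine cover, which yields antisymmetry.
⪯L⇒≈⊎< : {σ τ : 𝔖 (suc n)} → σ ⪯L τ → σ ≈ τ ⊎ invCount σ < invCount τ
⪯L⇒≈⊎< ε = inj₁ λ _ → refl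
⪯L⇒≈⊎< {σ = σ} {τ} (_◅_ {j = ρ} (inj₁ eq) rest) with ⪯L⇒≈⊎< rest
... | inj₁ eq′ = inj₁ λ k → trans (eq k) (eq′ k)
... | inj₂ lt  = inj₂ (subst (_< invCount τ) (sym (invCount-cong {σ = σ} {ρ} eq)) lt)
⪯L⇒≈⊎< {σ = σ} {τ} (_◅_ {j = ρ} (inj₂ (i , ¬d , eq)) rest) = inj₂ (subst (_≤ invCount τ) step (bound (⪯L⇒≈⊎< rest)))
  where
  step : invCount ρ ≡ suc (invCount σ)
  step = trans (invCount-cong {σ = ρ} {s i · σ} eq) (invCount-ascent σ i (¬Des-L⇒ascent σ ¬d))
  bound : ρ ≈ τ ⊎ invCount ρ < invCount τ → invCount ρ ≤ invCount τ
  bound (inj₁ eq′) = ≤-reflexive (invCount-cong {σ = ρ} {τ} eq′)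
  bound (inj₂ lt)  = <⇒≤ lt

⪯L-antisym : {σ τ : 𝔖 (suc n)} → σ ⪯L τ → τ ⪯L σ → σ ≈ τ
⪯L-antisym p q with ⪯L⇒≈⊎< p | ⪯L⇒≈⊎< q
... | inj₁ eq | _ = eq
... | inj₂ _ | inj₁ eq = sym ∘ eq
... | inj₂ lt | inj₂ lt′ = contradiction lt (<-asym lt′)

product-∷ʳ : (is : List (Fin n)) (i : Fin n) → product {suc n} (is ∷ʳ i) ≈ product is · s i
product-∷ʳ []       i k = refl
product-∷ʳ (j ∷ is) i k = cong (s j ⟨$⟩ʳ_) (product-∷ʳ is i k)

product-reverse : (is : List (Fin n)) → product {suc n} (List.reverse is) ≈ Perm.flip (product is)
product-reverse []       k = refl
product-reverse (i ∷ is) k = begin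
  product (List.reverse (i ∷ is)) ⟨$⟩ʳ k     ≡⟨ cong (λ js → product js ⟨$⟩ʳ k) (unfold-reverse i is) ⟩
  product (List.reverse is ∷ʳ i) ⟨$⟩ʳ k      ≡⟨ product-∷ʳ (List.reverse is) i k ⟩
  product (List.reverse is) ⟨$⟩ʳ (s i ⟨$⟩ʳ k) ≡⟨ product-reverse is _ ⟩
  product is ⟨$⟩ˡ (s i ⟨$⟩ʳ k)               ≡⟨ cong (product is ⟨$⟩ˡ_) (sym (s-inverse i k)) ⟩
  product is ⟨$⟩ˡ (s i ⟨$⟩ˡ k)               ∎
  where open ≡-Reasoning

flip-cong : {σ τ : 𝔖 n} → σ ≈ τ → Perm.flip σ ≈ Perm.flip τ
flip-cong {σ = σ} {τ} eq k = sym (trans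
  (sym (inverseˡ σ)) (cong (σ ⟨$⟩ˡ_) (trans (eq _) (inverseʳ τ))))

-- Reversing a reduced word expresses the inverse with the same number of letters; the inequality is
-- applied to `σ` and to its inverse.
invCount-flip : (σ : 𝔖 (suc n)) → invCount (Perm.flip σ) ≡ invCount σ
invCount-flip σ = ≤-antisym (go σ) (go (Perm.flip σ))
  where
  go : (σ : 𝔖 _) → invCount (Perm.flip σ) ≤ invCount σ
  go σ with is , len , prod ← proj₁ (isLength-invCount σ) = begin
    invCount (Perm.flip σ)              ≡⟨ invCount-cong {σ = Perm.flip σ} {product (List.reverse is)}
                                             (λ k → sym (trans (product-reverse is k)
                                               (flip-cong {σ = product is} {σ} prod k))) ⟩
    invCount (product (List.reverse is)) ≤⟨ invCount-product (List.reverse is) ⟩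
    length (List.reverse is)            ≡⟨ length-reverse is ⟩
    length is                           ≡⟨ len ⟩
    invCount σ                          ∎
    where open ≤-Reasoning

flip-·s : (σ : 𝔖 (suc n)) (i : Fin n) → Perm.flip (σ · s i) ≈ s i · Perm.flip σ
flip-·s σ i k = s-inverse i (σ ⟨$⟩ˡ k)

invCount-·s : (σ : 𝔖 (suc n)) (i : Fin n) → invCount (σ · s i) ≡ invCount (s i · Perm.flip σ)
invCount-·s σ i = trans (sym (invCount-flip (σ · s i)))
  (invCount-cong {σ = Perm.flip (σ · s i)} {s i · Perm.flip σ} (flip-·s σ i))

Des-R⇒Des-L : (σ : 𝔖 (suc n)) {i : Fin n} → i ∈ Des-R σ → i ∈ Des-L (Perm.flip σ)
Des-R⇒Des-L σ {i} d = <⇒<ℓ {σ = s i · Perm.flip σ} {Perm.flip σ}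
  (subst₂ _<_ (invCount-·s σ i) (sym (invCount-flip σ)) (<ℓ⇒< {σ = σ · s i} {σ} d))

Des-L⇒Des-R : (σ : 𝔖 (suc n)) {i : Fin n} → i ∈ Des-L (Perm.flip σ) → i ∈ Des-R σ
Des-L⇒Des-R σ {i} d = <⇒<ℓ {σ = σ · s i} {σ}
  (subst₂ _<_ (sym (invCount-·s σ i)) (invCount-flip σ) (<ℓ⇒< {σ = s i · Perm.flip σ} {Perm.flip σ} d))

-- Taking inverses preserves length and turns right multiplication by `s i` into left
-- multiplication, which reduces `⪯R` to the criterion `⊑` for `⪯L`.
⪯R⇒flip⪯L : {σ τ : 𝔖 (suc n)} → σ ⪯R τ → Perm.flip σ ⪯L Perm.flip τ
⪯R⇒flip⪯L = gmap Perm.flip λ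
  { {σ} {τ} (inj₁ eq) → inj₁ (flip-cong {σ = σ} {τ} eq)
  ; {σ} {τ} (inj₂ (i , ¬d , eq)) → inj₂ (i , ¬d ∘ Des-L⇒Des-R σ , λ k →
      trans (flip-cong {σ = τ} {σ · s i} eq k) (flip-·s σ i k)) }

flip⪯L⇒⪯R : {σ τ : 𝔖 (suc n)} → Perm.flip σ ⪯L Perm.flip τ → σ ⪯R τ
flip⪯L⇒⪯R = gmap Perm.flip λ
  { {σ} {τ} (inj₁ eq) → inj₁ (flip-cong {σ = σ} {τ} eq)
  ; {σ} {τ} (inj₂ (i , ¬d , eq)) → inj₂ (i , ¬d ∘ Des-R⇒Des-L (Perm.flip σ) , λ k →
      trans (flip-cong {σ = τ} {s i · σ} eq k) (cong (σ ⟨$⟩ˡ_) (s-inverse i k))) }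

-- Reading orders

to-injective : (F : X ↔ Y) {x y : X} → Inverse.to F x ≡ Inverse.to F y → x ≡ y
to-injective F = Injection.injective (↔⇒↣ F)

Lex : (κ₁ κ₂ : X → ℕ) → Rel X 0ℓ
Lex κ₁ κ₂ b c = κ₁ b < κ₁ c ⊎ κ₁ b ≡ κ₁ c × κ₂ b < κ₂ c

Lex-asym : (κ₁ κ₂ : X → ℕ) {b c : X} → Lex κ₁ κ₂ b c → ¬ Lex κ₁ κ₂ c b
Lex-asym κ₁ κ₂ (inj₁ p)        (inj₁ q)        = <-asym p q
Lex-asym κ₁ κ₂ (inj₁ p)        (inj₂ (eq , _)) = <-irrefl (sym eq) p
Lex-asym κ₁ κ₂ (inj₂ (eq , _)) (inj₁ q)        = <-irrefl (sym eq) q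
Lex-asym κ₁ κ₂ (inj₂ (_ , p))  (inj₂ (_ , q))  = <-asym p q

AllPairs-lookup : {R : Rel X 0ℓ} {xs : List X} → AllPairs R xs →
                  ∀ {i j} → i Fin.< j → R (lookup xs i) (lookup xs j)
AllPairs-lookup (px ∷ _)  {zero}  {suc j} _         = All.lookup px (∈-lookup j)
AllPairs-lookup (_ ∷ pxs) {suc i} {suc j} (s≤s i<j) = AllPairs-lookup pxs i<j

cartesianProductWith-AllPairs :
  {f : X → Y → Z} {k : X → ℕ} {l : Y → ℕ} {κ₁ κ₂ : Z → ℕ} →
  (∀ x y → κ₁ (f x y) ≡ k x) → (∀ x y → κ₂ (f x y) ≡ l y) →
  ∀ {xs ys} → AllPairs (_<_ on k) xs → AllPairs (_<_ on l) ys →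
  AllPairs (Lex κ₁ κ₂) (cartesianProductWith f xs ys)
cartesianProductWith-AllPairs eq₁ eq₂ [] _ = []
cartesianProductWith-AllPairs {f = f} {k} {l} {κ₁} {κ₂} eq₁ eq₂ {x ∷ xs} {ys} (x<xs ∷ pxs) pys = AllPairsₚ.++⁺
  (AllPairsₚ.map⁺ (AllPairs.map (λ {y} {y′} y<y′ →
    inj₂ (trans (eq₁ x y) (sym (eq₁ x y′)) , subst₂ _<_ (sym (eq₂ x y)) (sym (eq₂ x y′)) y<y′)) pys))
  (cartesianProductWith-AllPairs eq₁ eq₂ pxs pys)
  (Allₚ.map⁺ (All.universal (λ y → above y x<xs) ys))
  where
  above : ∀ y {zs} → All (λ z → k x < k z) zs → All (Lex κ₁ κ₂ (f x y)) (cartesianProductWith f zs ys)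
  above y []                 = []
  above y (_∷_ {x = z} p ps) = Allₚ.++⁺
    (Allₚ.map⁺ (All.universal (λ y′ → inj₁ (subst₂ _<_ (sym (eq₁ x y)) (sym (eq₁ z y′)) p)) ys))
    (above y ps)

-- The time at which the direction `π` visits the coordinate `i`.
key : 𝔖 n → Fin n → ℕ
key π i = toℕ (π ⟨$⟩ˡ i)

positions-sorted : (π : 𝔖 n) → AllPairs (_<_ on key π) (positions π)
positions-sorted π = AllPairsₚ.tabulate⁺-< λ i<j →
  subst₂ Fin._<_ (sym (inverseˡ π)) (sym (inverseˡ π)) i<j

-- This treats row and column readings at once: `outer` is the coordinate that varies slowly, in
-- direction `π`, and `inner` the one that varies quickly, in direction `ρ`.
record Lexicographic (o : ReadingOrder w h) (outer : Box w h → Fin a) (inner : Box w h → Fin b)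
                     (π : 𝔖 a) (ρ : 𝔖 b) : Set where
  field
    box       : Fin a → Fin b → Box w h
    outer-box : ∀ x y → outer (box x y) ≡ x
    inner-box : ∀ x y → inner (box x y) ≡ y
    boxes≡    : ReadingOrder.boxes o ≡ cartesianProductWith box (positions π) (positions ρ)

byColumns : (dx : 𝔖 w) (dy : 𝔖 h) → Lexicographic (columnByColumn dx dy) proj₁ proj₂ dx dy
byColumns dx dy = record
  { box = _,_ ; outer-box = λ _ _ → refl ; inner-box = λ _ _ → refl ; boxes≡ = refl }

byRows : (dx : 𝔖 w) (dy : 𝔖 h) → Lexicographic (rowByRow dx dy) proj₂ proj₁ dy dx
byRows dx dy = record
  { box = λ y x → x , y ; outer-box = λ _ _ → refl ; inner-box = λ _ _ → refl ; boxes≡ = refl }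

-- For `D = tcd α` this unfolds to `fill α o`, so the facts about `pos` in `Reading` apply to the
-- tableaux `𝖳 α` and `𝖳′ α` as well as to the readings `RB` and `BR`.
rank : (o : ReadingOrder w h) (D : Diagram w h) → .(length (listed o D) ≡ n) → Filling D n
rank o D eq = cast-id eq ↔-∘ ↔-sym (enumerate o D)

-- Counting blocks

length-filter-tabulate : {P : Pred X 0ℓ} (P? : Decidable P) (f : Fin n → X) →
  length (filter P? (tabulate f)) ≡ ∑ (λ i → ⌊ P? (f i) ⌋)
length-filter-tabulate {n = zero}  P? f = refl
length-filter-tabulate {n = suc n} P? f with P? (f zero)
... | yes _ = cong suc (length-filter-tabulate P? (f ∘ suc))
... | no _  = length-filter-tabulate P? (f ∘ suc)

length-filter-positions : {P : Pred (Fin n) 0ℓ} (P? : Decidable P) (π : 𝔖 n) →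
  length (filter P? (positions π)) ≡ length (filter P? (allFin n))
length-filter-positions P? π = trans (length-filter-tabulate P? (π ⟨$⟩ʳ_))
  (trans (sym (sum-permute (λ i → ⌊ P? i ⌋) π)) (sym (length-filter-tabulate P? id)))

length-filter-cartesianProductWith : {P : Pred Z 0ℓ} (P? : Decidable P) (f : X → Y → Z) (xs : List X) (ys : List Y) →
  length (filter P? (cartesianProductWith f xs ys)) ≡ sum (List.map (λ x → length (filter P? (List.map (f x) ys))) xs)
length-filter-cartesianProductWith P? f []       ys = refl
length-filter-cartesianProductWith P? f (x ∷ xs) ys = begin
  length (filter P? (List.map (f x) ys ++ cartesianProductWith f xs ys))
    ≡⟨ cong length (filter-++ P? (List.map (f x) ys) _) ⟩
  length (filter P? (List.map (f x) ys) ++ filter P? (cartesianProductWith f xs ys))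
    ≡⟨ length-++ (filter P? (List.map (f x) ys)) ⟩
  length (filter P? (List.map (f x) ys)) + length (filter P? (cartesianProductWith f xs ys))
    ≡⟨ cong (_ +_) (length-filter-cartesianProductWith P? f xs ys) ⟩
  _ ∎
  where open ≡-Reasoning

All-cartesianProductWith : {P : Pred Z 0ℓ} (f : X → Y → Z) {xs : List X} (ys : List Y) →
  All (λ x → ∀ y → P (f x y)) xs → All P (cartesianProductWith f xs ys)
All-cartesianProductWith f ys []       = []
All-cartesianProductWith f ys (p ∷ ps) =
  Allₚ.++⁺ (Allₚ.map⁺ (All.universal p ys)) (All-cartesianProductWith f ys ps)

lookup-initial : {P : Pred X 0ℓ} {xs ys zs : List X} → zs ≡ xs ++ ys → All P xs → All (∁ P) ys →
  ∀ i → (toℕ i < length xs → P (lookup zs i)) × (P (lookup zs i) → toℕ i < length xs)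
lookup-initial refl []         ¬ps i       = (λ ()) , λ p → contradiction p (All.lookup ¬ps (∈-lookup i))
lookup-initial refl (px ∷ pxs) ¬ps zero    = (λ _ → px) , λ _ → s≤s z≤n
lookup-initial refl (px ∷ pxs) ¬ps (suc i) with to , from ← lookup-initial refl pxs ¬ps i =
  to ∘ s≤s⁻¹ , s≤s ∘ from

-- The offset `c` absorbs the shift by `suc` in the induction; the eventual use has `c = 0`.
take-tabulate-< : ∀ k c (f : Fin n → X) {κ : X → ℕ} → (∀ i → κ (f i) ≡ c + toℕ i) →
  All (λ x → κ x < c + k) (take k (tabulate f))
take-tabulate-< zero    c f eq = []
take-tabulate-< {zero}  (suc k) c f eq = []
take-tabulate-< {suc n} (suc k) c f {κ} eq =
  subst (_< c + suc k) (sym (trans (eq zero) (+-identityʳ c))) (m<m+n c (s≤s z≤n)) ∷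
  subst (λ m → All (λ x → κ x < m) (take k (tabulate (f ∘ suc)))) (sym (+-suc c k))
    (take-tabulate-< k (suc c) (f ∘ suc) λ i → trans (eq (suc i)) (+-suc c (toℕ i)))

drop-tabulate-≮ : ∀ k c (f : Fin n → X) {κ : X → ℕ} → (∀ i → κ (f i) ≡ c + toℕ i) →
  All (λ x → ¬ κ x < c + k) (drop k (tabulate f))
drop-tabulate-≮ zero c f eq = Allₚ.tabulate⁺ λ i κ<c → <⇒≱ (subst₂ _<_ (eq i) (+-identityʳ c) κ<c) (m≤m+n c (toℕ i))
drop-tabulate-≮ {zero}  (suc k) c f eq = []
drop-tabulate-≮ {suc n} (suc k) c f {κ} eq =
  subst (λ m → All (λ x → ¬ κ x < m) (drop k (tabulate (f ∘ suc)))) (sym (+-suc c k))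
    (drop-tabulate-≮ k (suc c) (f ∘ suc) λ i → trans (eq (suc i)) (+-suc c (toℕ i)))

-- β v is the number of the block containing v when [n] is cut into consecutive blocks of sizes L.
record IsBlockFunction (L : List ℕ) (β : Fin n → ℕ) : Set where
  field
    before  : ∀ k v → toℕ v < sum (take k L) → β v < k
    before⁻ : ∀ k v → β v < k → toℕ v < sum (take k L)
    bounded : ∀ v → β v < length L

  β-mono : ∀ {u v} → u Fin.≤ v → β u ≤ β v
  β-mono {u} {v} u≤v = s≤s⁻¹ (before _ u (≤-<-trans u≤v (before⁻ (suc (β v)) v ≤-refl)))

-- The condition `β v < k` is determined by `L` alone; taking `k` one more than either block number
-- bounds the other.
block-unique : {L : List ℕ} {β β′ : Fin n → ℕ} → IsBlockFunction L β → IsBlockFunction L β′ → ∀ v → β v ≡ β′ v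
block-unique {β = β} {β′} B B′ v = ≤-antisym
  (s≤s⁻¹ (before B _ v (before⁻ B′ (suc (β′ v)) v ≤-refl)))
  (s≤s⁻¹ (before B′ _ v (before⁻ B (suc (β v)) v ≤-refl)))
  where open IsBlockFunction

module Reading {o : ReadingOrder w h} {outer : Box w h → Fin a} {inner : Box w h → Fin b} {π : 𝔖 a} {ρ : 𝔖 b}
               (lex : Lexicographic o outer inner π ρ) (D : Diagram w h) .(eq : length (listed o D) ≡ n) where
  open Lexicographic lex

  pos : Filling D n
  pos = rank o D eq

  _≺_ : Rel (Box w h) 0ℓ
  _≺_ = Lex (key π ∘ outer) (key ρ ∘ inner)

  lookup-from : ∀ c → lookup (listed o D) (Inverse.from (enumerate o D) c) ≡ proj₁ c
  lookup-from c = cong proj₁ (Inverse.strictlyInverseˡ (enumerate o D) c)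

  toℕ-pos : ∀ c → toℕ (Inverse.to pos c) ≡ toℕ (Inverse.from (enumerate o D) c)
  toℕ-pos c = toℕ-cast eq (Inverse.from (enumerate o D) c)

  pos-≺ : ∀ (c d : Cell D) → Inverse.to pos c Fin.< Inverse.to pos d → proj₁ c ≺ proj₁ d
  pos-≺ c d p = subst₂ _≺_ (lookup-from c) (lookup-from d)
    (AllPairs-lookup (AllPairsₚ.filter⁺ (T? ∘ D) sorted) (subst₂ _<_ (toℕ-pos c) (toℕ-pos d) p))
    where
    sorted : AllPairs _≺_ (ReadingOrder.boxes o)
    sorted = subst (AllPairs _≺_) (sym boxes≡) (cartesianProductWith-AllPairs
      (λ x y → cong (key π) (outer-box x y)) (λ x y → cong (key ρ) (inner-box x y))
      (positions-sorted π) (positions-sorted ρ))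

  pos-< : ∀ (c d : Cell D) → proj₁ c ≺ proj₁ d → Inverse.to pos c Fin.< Inverse.to pos d
  pos-< c d p with <-cmp (Inverse.to pos c) (Inverse.to pos d)
  ... | tri< q _ _ = q
  ... | tri> _ _ q = contradiction (pos-≺ d c q) (Lex-asym (key π ∘ outer) (key ρ ∘ inner) p)
  ... | tri≈ _ q _ with refl ← to-injective pos {c} {d} q =
    contradiction p (Lex-asym (key π ∘ outer) (key ρ ∘ inner) p)

  size : Fin a → ℕ
  size x = length (filter (T? ∘ D ∘ box x) (allFin b))

  size≡ : ∀ x → length (filter (T? ∘ D) (List.map (box x) (positions ρ))) ≡ size x
  size≡ x = trans (length-filter-map D (box x) (positions ρ)) (length-filter-positions (T? ∘ D ∘ box x) ρ)

  sizes : List ℕ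
  sizes = List.map size (positions π)

  blockOf : Cell D → ℕ
  blockOf c = key π (outer (proj₁ c))

  -- The first `k` lines in the outer direction contribute an initial segment of the listing, whose
  -- length is the sum of the first `k` sizes. Membership in it can be read off both from the
  -- position of a cell and from its block number.
  pos-before : ∀ k c → (toℕ (Inverse.to pos c) < sum (take k sizes) → blockOf c < k)
                     × (blockOf c < k → toℕ (Inverse.to pos c) < sum (take k sizes))
  pos-before k c =
    (λ p → subst (λ d → key π (outer d) < k) (lookup-from c) (proj₁ split (subst₂ _<_ (toℕ-pos c) (sym len) p))) ,
    (λ p → subst₂ _<_ (sym (toℕ-pos c)) len (proj₂ split (subst (λ d → key π (outer d) < k) (sym (lookup-from c)) p)))
    where
    ps = positions π
    part : List (Fin a) → List (Box w h)
    part xs = filter (T? ∘ D) (cartesianProductWith box xs (positions ρ))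

    listed≡ : listed o D ≡ part (take k ps) ++ part (drop k ps)
    listed≡ = begin
      listed o D
        ≡⟨ cong (filter (T? ∘ D)) boxes≡ ⟩
      part ps
        ≡⟨ cong part (sym (take++drop≡id k ps)) ⟩
      part (take k ps ++ drop k ps)
        ≡⟨ cong (filter (T? ∘ D)) (cartesianProductWith-distribʳ-++ box (take k ps) (drop k ps) _) ⟩
      filter (T? ∘ D) (cartesianProductWith box (take k ps) (positions ρ) ++
                       cartesianProductWith box (drop k ps) (positions ρ))
        ≡⟨ filter-++ (T? ∘ D) (cartesianProductWith box (take k ps) (positions ρ)) _ ⟩
      part (take k ps) ++ part (drop k ps) ∎
      where open ≡-Reasoning

    len : length (part (take k ps)) ≡ sum (take k sizes)
    len = trans (length-filter-cartesianProductWith (T? ∘ D) box (take k ps) (positions ρ))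
            (cong sum (trans (map-cong size≡ (take k ps)) (sym (take-map k ps))))

    spread : {Q : Pred ℕ 0ℓ} {xs : List (Fin a)} → All (Q ∘ key π) xs → All (Q ∘ key π ∘ outer) (part xs)
    spread {Q} all = Allₚ.filter⁺ (T? ∘ D) (All-cartesianProductWith box (positions ρ)
      (All.map (λ {x} q y → subst (Q ∘ key π) (sym (outer-box x y)) q) all))

    split = lookup-initial listed≡
      (spread {_< k} (take-tabulate-< k 0 (π ⟨$⟩ʳ_) λ i → cong toℕ (inverseˡ π)))
      (spread {λ m → ¬ m < k} (drop-tabulate-≮ k 0 (π ⟨$⟩ʳ_) λ i → cong toℕ (inverseˡ π)))
      (Inverse.from (enumerate o D) c)

  block-function : IsBlockFunction sizes (blockOf ∘ Inverse.from pos)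
  block-function = record
    { before  = λ k v p → proj₁ (pos-before k _) (subst (λ u → toℕ u < _) (sym (Inverse.strictlyInverseˡ pos v)) p)
    ; before⁻ = λ k v p → subst (λ u → toℕ u < _) (Inverse.strictlyInverseˡ pos v) (proj₂ (pos-before k _) p)
    ; bounded = λ v → subst (blockOf (Inverse.from pos v) <_)
        (sym (trans (length-map size (positions π)) (length-tabulate (π ⟨$⟩ʳ_))))
        (toℕ<n (π ⟨$⟩ˡ outer (proj₁ (Inverse.from pos v))))
    }

-- Longest elements

module _ {L : List ℕ} {β : Fin (suc n) → ℕ} (B : IsBlockFunction L β) where
  open IsBlockFunction B

  private
    S = ∁ (set (suc n) L)

  ∁set⇒≡ : ∀ {i} → i ∈ S → β (inject₁ i) ≡ β (suc i)
  ∁set⇒≡ {i} i∉set with m≤n⇒m<n∨m≡n (β-mono (<⇒≤ (i<1+i i)))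
  ... | inj₂ eq = eq
  ... | inj₁ lt = contradiction
    -- A jump means that a block starts at `suc i`: the `β (suc i)` blocks before it have total size
    -- `toℕ i + 1`, which puts `i` into `set`.
    (β (suc i) , ≤-trans (s≤s z≤n) lt , bounded (suc i) , ≤-antisym
      (≮⇒≥ λ q → <-irrefl refl (before _ (suc i) q))
      (subst (_< sum (take (β (suc i)) L)) (toℕ-inject₁ i) (before⁻ _ (inject₁ i) lt)))
    i∉set

  ≡⇒∁set : ∀ {i} → β (inject₁ i) ≡ β (suc i) → i ∈ S
  ≡⇒∁set {i} eq (k , _ , _ , sum≡) = <-irrefl (sym sum≡)
    (before⁻ k (suc i) (subst (_< k) eq (before k (inject₁ i)
      (subst₂ _<_ (sym (toℕ-inject₁ i)) (sym sum≡) (n<1+n _)))))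

  s-preserves : ∀ {i} → β (inject₁ i) ≡ β (suc i) → ∀ k → β (s i ⟨$⟩ʳ k) ≡ β k
  s-preserves {i} eq k with position i k
  ... | low       = trans (cong β (s-lo i)) (sym eq)
  ... | high      = trans (cong β (s-hi i)) eq
  ... | other p q = cong β (s-other i p q)

  ⟨⟩⇒preserves : ∀ {τ} → τ ∈ ⟨ S ⟩ → ∀ k → β (τ ⟨$⟩ʳ k) ≡ β k
  ⟨⟩⇒preserves (gen i∈S)          k = s-preserves (∁set⇒≡ i∈S) k
  ⟨⟩⇒preserves unit               k = refl
  ⟨⟩⇒preserves (mult {σ} {τ} p q) k = trans (⟨⟩⇒preserves p (τ ⟨$⟩ʳ k)) (⟨⟩⇒preserves q k)
  ⟨⟩⇒preserves (inv {σ} p)        k = trans (sym (⟨⟩⇒preserves p (σ ⟨$⟩ˡ k))) (cong β (inverseʳ σ))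
  ⟨⟩⇒preserves (resp eq p)        k = trans (cong β (sym (eq k))) (⟨⟩⇒preserves p k)

  -- As `β` is monotone and the inverse of `τ` preserves it, a descent `i` of `τ` yields both
  -- inequalities between `β (inject₁ i)` and `β (suc i)`. So `s i` lies in the subgroup, and
  -- cancelling it leaves a block preserving permutation with one inversion fewer.
  preserves⇒⟨⟩ : ∀ m τ → invCount τ ≡ m → (∀ k → β (τ ⟨$⟩ʳ k) ≡ β k) → τ ∈ ⟨ S ⟩
  preserves⇒⟨⟩ m τ eq pres with descent⊎id τ
  ... | inj₂ τ≈id = resp (sym ∘ τ≈id) unit
  preserves⇒⟨⟩ zero τ eq pres | inj₁ (i , des) with () ← trans (sym eq) (invCount-descent τ i des)
  preserves⇒⟨⟩ (suc m) τ eq pres | inj₁ (i , des) =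
    resp {σ = s i · (s i · τ)} (λ k → s-involutive i (τ ⟨$⟩ʳ k)) (mult (gen (≡⇒∁set same))
      (preserves⇒⟨⟩ m (s i · τ) (suc-injective (trans (sym (invCount-descent τ i des)) eq))
        λ k → trans (s-preserves same (τ ⟨$⟩ʳ k)) (pres k)))
    where
    pulled : ∀ k → β (τ ⟨$⟩ˡ k) ≡ β k
    pulled k = trans (sym (pres (τ ⟨$⟩ˡ k))) (cong β (inverseʳ τ))
    same : β (inject₁ i) ≡ β (suc i)
    same = ≤-antisym (β-mono (<⇒≤ (i<1+i i)))
      (subst₂ _≤_ (pulled (suc i)) (pulled (inject₁ i)) (β-mono (<⇒≤ des)))

  -- Elements of the subgroup invert pairs inside one block only, and `σ` inverts all of those.
  -- Hence each of them is below `σ` in `⪯L`, and therefore equal to it or shorter.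
  longest : ∀ {σ} → (∀ k → β (σ ⟨$⟩ʳ k) ≡ β k) →
            (∀ {u v} → u Fin.< v → β u ≡ β v → σ ⟨$⟩ʳ v Fin.< σ ⟨$⟩ʳ u) → Is-w₀⟨ S ⟩ σ
  longest {σ} pres rev = preserves⇒⟨⟩ _ σ refl pres , λ τ τ∈ →
    [ inj₁ , inj₂ ∘ <⇒<ℓ {σ = τ} {σ} ]′ (⪯L⇒≈⊎< (⊑⇒⪯L {σ = τ} {σ} λ {u} {v} (u<v , τv<τu) →
      u<v , rev u<v (≤-antisym (β-mono (<⇒≤ u<v))
        (subst₂ _≤_ (⟨⟩⇒preserves τ∈ v) (⟨⟩⇒preserves τ∈ u) (β-mono (<⇒≤ τv<τu))))))

opposite-< : {i j : Fin n} → i Fin.< j → opposite j Fin.< opposite i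
opposite-< {n} {i} {j} i<j = subst₂ _<_ (sym (opposite-prop j)) (sym (opposite-prop i))
  (∸-monoʳ-< (s≤s i<j) (toℕ<n j))

reverse-w₀ : Is-w₀ {suc n} Perm.reverse
reverse-w₀ = tt , λ τ _ →
  [ inj₁ , inj₂ ∘ <⇒<ℓ {σ = τ} {Perm.reverse} ]′
    (⪯L⇒≈⊎< (⊑⇒⪯L {σ = τ} {Perm.reverse} λ (u<v , _) → u<v , opposite-< u<v))

-- The transition between the two numberings is increasing, hence trivial. This identifies
-- numberings that list the cells in the same order.
rigid : (F G : X ↔ Fin n) → (∀ {x y} → Inverse.to F x Fin.< Inverse.to F y → Inverse.to G x Fin.< Inverse.to G y) →
        ∀ x → Inverse.to G x ≡ Inverse.to F x
rigid F G mono x = trans (cong (Inverse.to G) (sym (Inverse.strictlyInverseʳ F x)))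
  (monotone⇒id (G ↔-∘ ↔-sym F) (λ u<v → mono (subst₂ Fin._<_
    (sym (Inverse.strictlyInverseˡ F _)) (sym (Inverse.strictlyInverseˡ F _)) u<v)) (Inverse.to F x))

opposite-<⁻ : {i j : Fin n} → opposite i Fin.< opposite j → j Fin.< i
opposite-<⁻ p = subst₂ Fin._<_ (opposite-involutive _) (opposite-involutive _) (opposite-< p)

opposite-≤ : {i j : Fin n} → i Fin.≤ j → opposite j Fin.≤ opposite i
opposite-≤ le = ≮⇒≥ λ lt → <⇒≱ (opposite-<⁻ lt) le

-- Equal block sizes make the transition permutation preserve blocks, and opposite inner directions
-- make it reverse each of them; this is what `longest` asks for.
block-reversal : {o₁ o₂ : ReadingOrder w h} {outer : Box w h → Fin a} {inner : Box w h → Fin b}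
  {π : 𝔖 a} {ρ₁ ρ₂ : 𝔖 b} (l₁ : Lexicographic o₁ outer inner π ρ₁) (l₂ : Lexicographic o₂ outer inner π ρ₂)
  (D : Diagram w h) (eq₁ : length (listed o₁ D) ≡ suc n) (eq₂ : length (listed o₂ D) ≡ suc n) {L : List ℕ} →
  Reading.sizes l₁ D eq₁ ≡ L → Reading.sizes l₂ D eq₂ ≡ L →
  (∀ {x y} → key ρ₁ x < key ρ₁ y → key ρ₂ y < key ρ₂ x) →
  Is-w₀⟨ ∁ (set (suc n) L) ⟩ (rank o₂ D eq₂ ↔-∘ ↔-sym (rank o₁ D eq₁))
block-reversal {outer = outer} {inner} {π} {ρ₁} {ρ₂} l₁ l₂ D eq₁ eq₂ refl sizes≡ reversed =
  longest R₁.block-function preserves reverses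
  where
  module R₁ = Reading l₁ D eq₁
  module R₂ = Reading l₂ D eq₂
  preserves : ∀ k → R₁.blockOf (Inverse.from R₁.pos (Inverse.to R₂.pos (Inverse.from R₁.pos k)))
                  ≡ R₁.blockOf (Inverse.from R₁.pos k)
  preserves k = trans
    (block-unique R₁.block-function
      (subst (λ L → IsBlockFunction L (R₂.blockOf ∘ Inverse.from R₂.pos)) sizes≡ R₂.block-function)
      (Inverse.to R₂.pos (Inverse.from R₁.pos k)))
    (cong R₁.blockOf (Inverse.strictlyInverseʳ R₂.pos (Inverse.from R₁.pos k)))
  reverses : ∀ {u v} → u Fin.< v → R₁.blockOf (Inverse.from R₁.pos u) ≡ R₁.blockOf (Inverse.from R₁.pos v) →
             Inverse.to R₂.pos (Inverse.from R₁.pos v) Fin.< Inverse.to R₂.pos (Inverse.from R₁.pos u)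
  reverses {u} {v} u<v same = R₂.pos-< d c ([ (λ p → contradiction p (<-irrefl same)) ,
      (λ (_ , p) → inj₂ (sym same , reversed p)) ]′
    (R₁.pos-≺ c d (subst₂ Fin._<_ (sym (Inverse.strictlyInverseˡ R₁.pos u)) (sym (Inverse.strictlyInverseˡ R₁.pos v)) u<v)))
    where
    c d : Cell D
    c = Inverse.from R₁.pos u
    d = Inverse.from R₁.pos v

-- The block sizes of the row and column readings of tcd α

sort↓-↭ : ∀ xs → sort↓ xs ↭ xs
sort↓-↭ = Sort.sort-↭ (Flip.decTotalOrder ≤-decTotalOrder)

max-↭ : {xs ys : List ℕ} → xs ↭ ys → max 0 xs ≡ max 0 ys
max-↭ {xs} {ys} p = ≤-antisym
  (max-mono-⊆ {xs = xs} {ys} ≤-refl (∈-resp-↭ p)) (max-mono-⊆ {xs = ys} {xs} ≤-refl (∈-resp-↭ (↭-sym p)))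

tabulate-opposite : (g : ℕ → X) (n : ℕ) → tabulate {n = n} (g ∘ toℕ ∘ opposite) ≡ applyDownFrom g n
tabulate-opposite g zero    = refl
tabulate-opposite g (suc n) = cong₂ _∷_ (cong g (toℕ-fromℕ n))
  (trans (tabulate-cong (λ i → cong g (toℕ-inject₁ (opposite i)))) (tabulate-opposite g n))

module _ (α : Composition n) where

  map-lookup-allFin : List.map (lookup (parts α)) (allFin (rows α)) ≡ parts α
  map-lookup-allFin = trans (map-tabulate id (lookup (parts α))) (tabulate-lookup (parts α))

  row-sizes : List.map (λ y → length (filter (T? ∘ tcd α ∘ (_, y)) (allFin (width α)))) (positions forwards) ≡ parts α
  row-sizes = trans
    (map-cong (λ y → length-initial (All.lookup (xs≤max 0 (parts α)) (∈-lookup y))) (allFin (rows α)))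
    map-lookup-allFin

  column-size : ∀ x → length (filter (T? ∘ tcd α ∘ (x ,_)) (allFin (rows α)))
                    ≡ length (filter (toℕ x <?_) (sort↓ (parts α)))
  column-size x = begin
    length (filter (T? ∘ tcd α ∘ (x ,_)) (allFin (rows α)))
      ≡⟨ sym (length-filter-map (toℕ x <ᵇ_) (lookup (parts α)) (allFin (rows α))) ⟩
    length (filter (T? ∘ (toℕ x <ᵇ_)) (List.map (lookup (parts α)) (allFin (rows α))))
      ≡⟨ cong (length ∘ filter (T? ∘ (toℕ x <ᵇ_))) map-lookup-allFin ⟩
    length (filter (T? ∘ (toℕ x <ᵇ_)) (parts α))
      ≡⟨ cong length (filter-≐ (T? ∘ (toℕ x <ᵇ_)) (toℕ x <?_) ((λ {y} → <ᵇ⇒< (toℕ x) y) , <⇒<ᵇ) (parts α)) ⟩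
    length (filter (toℕ x <?_) (parts α))
      ≡⟨ ↭-length (filter-↭ (toℕ x <?_) (↭-sym (sort↓-↭ (parts α)))) ⟩
    length (filter (toℕ x <?_) (sort↓ (parts α))) ∎
    where open ≡-Reasoning

  -- Sorting the rows changes neither the column lengths nor the number of columns, and going from
  -- right to left reverses the conjugate partition.
  column-sizes : List.map (λ x → length (filter (T? ∘ tcd α ∘ (x ,_)) (allFin (rows α)))) (positions backwards)
               ≡ List.reverse (conjugate (sort↓ (parts α)))
  column-sizes = begin
    List.map (λ x → length (filter (T? ∘ tcd α ∘ (x ,_)) (allFin (rows α)))) (positions backwards)
      ≡⟨ map-cong column-size (positions backwards) ⟩
    List.map (g ∘ toℕ) (tabulate opposite)
      ≡⟨ map-tabulate opposite (g ∘ toℕ) ⟩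
    tabulate {n = width α} (g ∘ toℕ ∘ opposite)
      ≡⟨ tabulate-opposite g (width α) ⟩
    applyDownFrom g (width α)
      ≡⟨ sym (reverse-applyUpTo g (width α)) ⟩
    List.reverse (applyUpTo g (width α))
      ≡⟨ cong List.reverse (sym (map-upTo g (width α))) ⟩
    List.reverse (List.map g (upTo (width α)))
      ≡⟨ cong (List.reverse ∘ List.map g ∘ upTo) (max-↭ (↭-sym (sort↓-↭ (parts α)))) ⟩
    List.reverse (conjugate (sort↓ (parts α))) ∎
    where
    open ≡-Reasoning
    g : ℕ → ℕ
    g j = length (filter (j <?_) (sort↓ (parts α)))

-- Covers and descent preserving isomorphisms

Descent-resp : {σ τ : 𝔖 (suc n)} → σ ≈ τ → ∀ {i} → Descent σ i → Descent τ i
Descent-resp {σ = σ} {τ} eq = subst₂ Fin._<_ (flip-cong {σ = σ} {τ} eq _) (flip-cong {σ = σ} {τ} eq _)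

Ascent-resp : {σ τ : 𝔖 (suc n)} → σ ≈ τ → ∀ {i} → Ascent σ i → Ascent τ i
Ascent-resp {σ = σ} {τ} eq = subst₂ Fin._<_ (flip-cong {σ = σ} {τ} eq _) (flip-cong {σ = σ} {τ} eq _)

≈⇒⪯L : {σ τ : 𝔖 n} → σ ≈ τ → σ ⪯L τ
≈⇒⪯L eq = inj₁ eq ◅ ε

⋖⇒⪯L : {σ τ : 𝔖 (suc n)} (i : Fin n) → Ascent σ i → τ ≈ s i · σ → σ ⪯L τ
⋖⇒⪯L {σ = σ} i asc eq = inj₂ (i , ascent⇒¬Des-L σ asc , eq) ◅ ε

first-step : {σ τ : 𝔖 (suc n)} → σ ⪯L τ → σ ≈ τ ⊎ (∃[ j ] Ascent σ j × s j · σ ⪯L τ)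
first-step ε = inj₁ λ _ → refl
first-step {σ = σ} (_◅_ {j = ρ} (inj₁ eq) rest) with first-step rest
... | inj₁ eq′              = inj₁ λ k → trans (eq k) (eq′ k)
... | inj₂ (j , asc , rest′) = inj₂ (j , Ascent-resp {σ = ρ} {σ} (sym ∘ eq) asc , inj₁ (cong (s j ⟨$⟩ʳ_) ∘ eq) ◅ rest′)
first-step {σ = σ} (inj₂ (i , ¬d , eq) ◅ rest) = inj₂ (i , ¬Des-L⇒ascent σ ¬d , inj₁ (sym ∘ eq) ◅ rest)

-- Multiplication by s j turns no other ascent into a descent, since if |i - j| = 1 then the
-- three values involved occur from left to right.
descent-created : (σ : 𝔖 (suc n)) (i j : Fin n) → Ascent σ i → Ascent σ j → Descent (s j · σ) i → i ≡ j
descent-created σ i j asc-i asc-j des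
  with des′ ← subst₂ Fin._<_ (cong (σ ⟨$⟩ˡ_) (s-inverse j (suc i))) (cong (σ ⟨$⟩ˡ_) (s-inverse j (inject₁ i))) des
  with inject₁ i in eq₁ | suc i in eq₂ | position j (inject₁ i) | position j (suc i)
... | _ | _ | low | _ = inject₁-injective eq₁
... | _ | _ | _ | high = Finₚ.suc-injective eq₂
... | _ | _ | high | low = contradiction (subst₂ Fin._<_ eq₁ eq₂ (i<1+i i)) (<-asym (i<1+i j))
... | _ | _ | high | other p q rewrite s-hi j | s-other j p q =
  contradiction des′ (<-asym (<-trans asc-j asc-i))
... | _ | _ | other p q | low rewrite s-lo j | s-other j p q =
  contradiction des′ (<-asym (<-trans asc-i asc-j))
... | _ | _ | other p q | other p′ q′ rewrite s-other j p q | s-other j p′ q′ = contradiction des′ (<-asym asc-i)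

⋖-≉ : {σ τ : 𝔖 (suc n)} (i : Fin n) → Ascent σ i → τ ≈ s i · σ → ¬ σ ≈ τ
⋖-≉ {σ = σ} {τ} i asc τ≈ σ≈τ = <-irrefl (trans (invCount-cong {σ = σ} {τ} σ≈τ) (invCount-cong {σ = τ} {s i · σ} τ≈))
  (subst (invCount σ <_) (sym (invCount-ascent σ i asc)) (n<1+n _))

-- The number of inversions grows by exactly one along a cover, which leaves no room for a further
-- element.
⋖-between : {σ ρ τ : 𝔖 (suc n)} (i : Fin n) → Ascent σ i → τ ≈ s i · σ → σ ⪯L ρ → ρ ⪯L τ → σ ≈ ρ ⊎ ρ ≈ τ
⋖-between {σ = σ} {ρ} {τ} i asc τ≈ σ⪯ρ ρ⪯τ with ⪯L⇒≈⊎< σ⪯ρ | ⪯L⇒≈⊎< ρ⪯τ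
... | inj₁ eq | _       = inj₁ eq
... | inj₂ _  | inj₁ eq = inj₂ eq
... | inj₂ p  | inj₂ q  = contradiction
  (s≤s⁻¹ (subst (invCount ρ <_) (trans (invCount-cong {σ = τ} {s i · σ} τ≈) (invCount-ascent σ i asc)) q))
  (<⇒≱ p)

Convex : Pred (𝔖 n) 0ℓ → Set
Convex X = ∀ {σ ρ τ} → σ ∈ X → τ ∈ X → σ ⪯L ρ → ρ ⪯L τ → ρ ∈ X

-- A descent preserving isomorphism of convex sets maps covers to covers with the same label,
-- hence is a right translation on everything above a given element.
module DescentIsomorphism {X Y : Pred (𝔖 (suc n)) 0ℓ} (X-convex : Convex X) (Y-convex : Convex Y) (X∼Y : X ∼D Y) where

  f : ∃ X → ∃ Y
  f = proj₁ X∼Y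

  g : ∃ X → 𝔖 (suc n)
  g = proj₁ ∘ f

  open IsOrderIsomorphism (proj₁ (proj₂ X∼Y)) public using (mono; injective; cancel; surjective)
    renaming (cong to g-cong)

  preimage : (y : ∃ Y) → ∃ λ γ → g γ ≈ proj₁ y
  preimage y = proj₁ (surjective y) , proj₂ (surjective y) {proj₁ (surjective y)} (λ _ → refl)

  g-descent : (γ : ∃ X) {i : Fin n} → Descent (proj₁ γ) i → Descent (g γ) i
  g-descent γ d = Des-L⇒descent (g γ) (proj₂ (proj₂ (proj₂ X∼Y) γ) (descent⇒Des-L (proj₁ γ) d))

  g-descent⁻ : (γ : ∃ X) {i : Fin n} → Descent (g γ) i → Descent (proj₁ γ) i
  g-descent⁻ γ d = Des-L⇒descent (proj₁ γ) (proj₁ (proj₂ (proj₂ X∼Y) γ) (descent⇒Des-L (g γ) d))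

  g-ascent : (γ : ∃ X) {i : Fin n} → Ascent (proj₁ γ) i → Ascent (g γ) i
  g-ascent γ {i} asc =
    [ id , (λ d → contradiction (g-descent⁻ γ d) (<-asym asc)) ]′ (ascent⊎descent (g γ) i)

  -- The image of the cover is a relation whose first step has some label `j`. By convexity the
  -- element reached lies in `Y`; its preimage is caught between `γ` and `δ` and is therefore `δ`.
  -- Since `i` becomes a descent at `δ`, it does so in the image, and `descent-created` gives
  -- `i ≡ j`.
  g-step : (γ δ : ∃ X) (i : Fin n) → Ascent (proj₁ γ) i → proj₁ δ ≈ s i · proj₁ γ → g δ ≈ s i · g γ
  g-step γ δ i asc δ≈ with first-step (mono {γ} {δ} (⋖⇒⪯L i asc δ≈))
  ... | inj₁ eq = contradiction (injective {γ} {δ} eq) (⋖-≉ {σ = proj₁ γ} {proj₁ δ} i asc δ≈)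
  ... | inj₂ (j , asc-j , le) = conclude
    where
    y : ∃ Y
    y = s j · g γ , Y-convex (proj₂ (f γ)) (proj₂ (f δ)) (⋖⇒⪯L j asc-j (λ _ → refl)) le
    η : ∃ X
    η = proj₁ (preimage y)
    gη≈ : g η ≈ s j · g γ
    gη≈ = proj₂ (preimage y)
    η≈δ : proj₁ η ≈ proj₁ δ
    η≈δ = [ (λ γ≈η → contradiction (g-cong {γ} {η} γ≈η) (⋖-≉ {σ = g γ} {g η} j asc-j gη≈)) , id ]′
      (⋖-between i asc δ≈ (cancel {γ} {η} (⋖⇒⪯L j asc-j gη≈)) (cancel {η} {δ} (inj₁ gη≈ ◅ le)))
    gδ≈ : g δ ≈ s j · g γ
    gδ≈ k = trans (sym (g-cong {η} {δ} η≈δ k)) (gη≈ k)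
    i≡j : i ≡ j
    i≡j = descent-created (g γ) i j (g-ascent γ asc) asc-j (Descent-resp {σ = g δ} {s j · g γ} gδ≈ {i} (g-descent δ {i}
      (Descent-resp {σ = s i · proj₁ γ} {proj₁ δ} (sym ∘ δ≈) {i} (ascent⇒descent-s (proj₁ γ) asc))))
    conclude : g δ ≈ s i · g γ
    conclude = subst (λ j → g δ ≈ s j · g γ) (sym i≡j) gδ≈

  -- Left multiplication by the labels of a chain commutes with the right factor `ξ`, which is
  -- therefore the same all the way up.
  translate : ∀ {σ γ} (σ∈ : σ ∈ X) (γ∈ : γ ∈ X) → σ ⪯L γ → (ξ : 𝔖 (suc n)) →
              g (σ , σ∈) ≈ σ · ξ → g (γ , γ∈) ≈ γ · ξ
  translate σ∈ γ∈ ε ξ eq k = trans (g-cong {_ , γ∈} {_ , σ∈} (λ _ → refl) k) (eq k)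
  translate {σ} σ∈ γ∈ (_◅_ {j = ρ} step rest) ξ eq = translate ρ∈ γ∈ rest ξ (advance step)
    where
    ρ∈ : ρ ∈ X
    ρ∈ = X-convex σ∈ γ∈ (step ◅ ε) rest
    advance : σ ≈ ρ ⊎ σ ⋖L ρ → g (ρ , ρ∈) ≈ ρ · ξ
    advance (inj₁ σ≈ρ) k = trans (g-cong {ρ , ρ∈} {σ , σ∈} (sym ∘ σ≈ρ) k) (trans (eq k) (σ≈ρ _))
    advance (inj₂ (i , ¬d , ρ≈)) k =
      trans (g-step (σ , σ∈) (ρ , ρ∈) i (¬Des-L⇒ascent σ ¬d) ρ≈ k)
        (trans (cong (s i ⟨$⟩ʳ_) (eq k)) (sym (ρ≈ _)))

-- Standard extended tableaux and admissible readings

module _ (α : Composition (suc n)) where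

  private
    N = suc n

    C : Set
    C = Cell (tcd α)

    Fill : Set
    Fill = Filling (tcd α) N

    infixl 8 _$_
    _$_ : Fill → C → Fin N
    _$_ = Inverse.to

    col : C → Fin (width α)
    col c = proj₁ (proj₁ c)

    row : C → Fin (rows α)
    row c = proj₂ (proj₁ c)

  cell-ext : {c d : C} → col c ≡ col d → row c ≡ row d → c ≡ d
  cell-ext {c} {d} p q = cell-≡ {D = tcd α} {c} {d} (cong₂ _,_ p q)

  <⇒cell≢ : (F : Fill) {c d : C} → F $ c Fin.< F $ d → c ≢ d
  <⇒cell≢ F lt refl = <-irrefl refl lt

  ≤∧cell≢⇒< : (F : Fill) {c d : C} → F $ c Fin.≤ F $ d → c ≢ d → F $ c Fin.< F $ d
  ≤∧cell≢⇒< F le c≢d = ≤∧≢⇒<F le (c≢d ∘ to-injective F)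

  Increasing : Fill → Set
  Increasing F = ∀ c d → col c Fin.≤ col d → row c Fin.≤ row d → F $ c Fin.≤ F $ d

  SouthEast : Fill → Set
  SouthEast ω = ∀ c d → col c Fin.≤ col d → row d Fin.≤ row c → ω $ d Fin.≤ ω $ c

  -- Every weak inequality of boxes factors through the box in the column of the first
  -- and the row of the second: rows of tcd α are left-justified.
  corner : (c d : C) → col c Fin.≤ col d → C
  corner c d p = (col c , row d) , <⇒<ᵇ (≤-<-trans p (<ᵇ⇒< (toℕ (col d)) (lookup (parts α) (row d)) (proj₂ d)))

  Increasing-intro : (F : Fill) →
    (∀ c d → row c ≡ row d → col c Fin.< col d → F $ c Fin.< F $ d) →
    (∀ c d → col c ≡ col d → row c Fin.< row d → F $ c Fin.< F $ d) → Increasing F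
  Increasing-intro F rows< cols< c d p q = ≤-trans vertical horizontal
    where
    e = corner c d p
    vertical : F $ c Fin.≤ F $ e
    vertical with m≤n⇒m<n∨m≡n q
    ... | inj₁ lt = <⇒≤ (cols< c e refl lt)
    ... | inj₂ eq = ≤-reflexive (cong (toℕ ∘ (F $_)) (cell-ext {c} {e} refl (toℕ-injective eq)))
    horizontal : F $ e Fin.≤ F $ d
    horizontal with m≤n⇒m<n∨m≡n p
    ... | inj₁ lt = <⇒≤ (rows< e d refl lt)
    ... | inj₂ eq = ≤-reflexive (cong (toℕ ∘ (F $_)) (cell-ext {e} {d} (toℕ-injective eq) refl))

  SouthEast-intro : (ω : Fill) →
    (∀ c d → row c ≡ row d → col c Fin.< col d → ω $ d Fin.< ω $ c) →
    (∀ c d → col c ≡ col d → row c Fin.< row d → ω $ c Fin.< ω $ d) → SouthEast ω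
  SouthEast-intro ω rows< cols< c d p q = ≤-trans horizontal vertical
    where
    e = corner c d p
    vertical : ω $ e Fin.≤ ω $ c
    vertical with m≤n⇒m<n∨m≡n q
    ... | inj₁ lt = <⇒≤ (cols< e c refl lt)
    ... | inj₂ eq = ≤-reflexive (cong (toℕ ∘ (ω $_)) (cell-ext {e} {c} refl (toℕ-injective eq)))
    horizontal : ω $ d Fin.≤ ω $ e
    horizontal with m≤n⇒m<n∨m≡n p
    ... | inj₁ lt = <⇒≤ (rows< e d refl lt)
    ... | inj₂ eq = ≤-reflexive (cong (toℕ ∘ (ω $_)) (cell-ext {d} {e} (sym (toℕ-injective eq)) refl))

  Increasing-resp : {F G : Fill} → (∀ c → F $ c ≡ G $ c) → Increasing F → Increasing G
  Increasing-resp eq inc c d p q = subst₂ Fin._≤_ (eq c) (eq d) (inc c d p q)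

  IsSET⇒Increasing : {F : Fill} → IsSET α F → Increasing F
  IsSET⇒Increasing {F} set = Increasing-intro F
    (λ { (_ , p) (_ , q) refl → rows-increase p q })
    (λ { (_ , p) (_ , q) refl → columns-increase p q })
    where open IsSET set

  Increasing⇒IsSET : {F : Fill} → Increasing F → IsSET α F
  Increasing⇒IsSET {F} inc = record
    { rows-increase = λ p q lt → ≤∧cell≢⇒< F (inc (_ , p) (_ , q) (<⇒≤ lt) ≤-refl) λ { refl → <-irrefl refl lt }
    ; columns-increase = λ p q lt → ≤∧cell≢⇒< F (inc (_ , p) (_ , q) ≤-refl (<⇒≤ lt)) λ { refl → <-irrefl refl lt }
    }

  infixl 7 _⊘_
  -- The word obtained when the entries of `F` are read in the order `ω`; exchanging the arguments
  -- gives the inverse permutation.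
  _⊘_ : Fill → Fill → 𝔖 N
  F ⊘ ω = F ↔-∘ ↔-sym ω

  ⊘-↔-∘ : (σ : 𝔖 N) (ω : Fill) → (σ ↔-∘ ω) ⊘ ω ≈ σ
  ⊘-↔-∘ σ ω k = cong (σ ⟨$⟩ʳ_) (Inverse.strictlyInverseˡ ω k)

  ↔-∘-⊘ : (F ω : Fill) → ∀ c → ((F ⊘ ω) ↔-∘ ω) $ c ≡ F $ c
  ↔-∘-⊘ F ω c = cong (F $_) (Inverse.strictlyInverseʳ ω c)

  inversion⁺ : (F ω : Fill) {c d : C} → ω $ c Fin.< ω $ d → F $ d Fin.< F $ c → Inversion (F ⊘ ω) (ω $ c) (ω $ d)
  inversion⁺ F ω {c} {d} p q = p , subst₂ Fin._<_ (sym (↔-∘-⊘ F ω d)) (sym (↔-∘-⊘ F ω c)) q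

  inversion⁻ : (F ω : Fill) {c d : C} → Inversion (F ⊘ ω) (ω $ c) (ω $ d) → F $ d Fin.< F $ c
  inversion⁻ F ω {c} {d} (_ , q) = subst₂ Fin._<_ (↔-∘-⊘ F ω d) (↔-∘-⊘ F ω c) q

  ⊑-intro : (F G ω : Fill) → (∀ c d → ω $ c Fin.< ω $ d → F $ d Fin.< F $ c → G $ d Fin.< G $ c) → F ⊘ ω ⊑ G ⊘ ω
  ⊑-intro F G ω h (p , q) = p , h _ _
    (subst₂ Fin._<_ (sym (Inverse.strictlyInverseˡ ω _)) (sym (Inverse.strictlyInverseˡ ω _)) p) q

  -- The left weak order on reading words, expressed without reference to the reading order.
  infix 4 _≼_
  _≼_ : Rel Fill 0ℓ
  F ≼ G = ∀ c d → col c Fin.≤ col d → row d Fin.≤ row c → F $ c Fin.< F $ d → G $ c Fin.< G $ d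

  ⊑⇒≼ : (F G ω : Fill) → SouthEast ω → F ⊘ ω ⊑ G ⊘ ω → F ≼ G
  ⊑⇒≼ F G ω se le c d p q lt = inversion⁻ G ω
    (le (inversion⁺ F ω (≤∧cell≢⇒< ω (se c d p q) (<⇒cell≢ F lt ∘ sym)) lt))

  -- In three of the four relative positions of two cells, `Increasing` and `SouthEast` either
  -- exclude an inversion or force it for `G`; the remaining position is the one that `≼` speaks of.
  ≼⇒⊑ : (F G ω : Fill) → SouthEast ω → Increasing F → Increasing G → F ≼ G → F ⊘ ω ⊑ G ⊘ ω
  ≼⇒⊑ F G ω se incF incG le = ⊑-intro F G ω go
    where
    go : ∀ c d → ω $ c Fin.< ω $ d → F $ d Fin.< F $ c → G $ d Fin.< G $ c
    go c d p q with ≤-total (col c) (col d) | ≤-total (row c) (row d)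
    ... | inj₁ x | inj₁ y = contradiction (incF c d x y) (<⇒≱ q)
    ... | inj₁ x | inj₂ y = contradiction (se c d x y) (<⇒≱ p)
    ... | inj₂ x | inj₁ y = le d c x y q
    ... | inj₂ x | inj₂ y = ≤∧cell≢⇒< G (incG d c x y) (<⇒cell≢ F q)

  descent-transfer : (F ω ω′ : Fill) → Increasing F → SouthEast ω → SouthEast ω′ →
                     ∀ {i} → Descent (F ⊘ ω) i → Descent (F ⊘ ω′) i
  descent-transfer F ω ω′ inc se se′ {i} des = go
    where
    c = Inverse.from F (inject₁ i)
    d = Inverse.from F (suc i)
    Fc = Inverse.strictlyInverseˡ F (inject₁ i)
    Fd = Inverse.strictlyInverseˡ F (suc i)
    c<d : F $ c Fin.< F $ d
    c<d = subst₂ Fin._<_ (sym Fc) (sym Fd) (i<1+i i)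
    done : col c Fin.≤ col d → row d Fin.≤ row c → ω′ $ d Fin.< ω′ $ c
    done x y = ≤∧cell≢⇒< ω′ (se′ c d x y) (<⇒cell≢ F c<d ∘ sym)
    go : ω′ $ d Fin.< ω′ $ c
    go with ≤-total (col c) (col d) | ≤-total (row c) (row d)
    ... | inj₁ x | inj₂ y = done x y
    ... | inj₂ x | inj₂ y = contradiction (inc d c x y) (<⇒≱ c<d)
    ... | inj₂ x | inj₁ y = contradiction (se d c x y) (<⇒≱ des)
    -- The entry in the corner lies weakly between two consecutive entries, so the corner is `c` or
    -- `d`, and these share a row or a column. In a row they are in south-east position as well; in
    -- a column `ω` has no descent at `i`.
    ... | inj₁ x | inj₁ y with m≤n⇒m<n∨m≡n (inc c (corner c d x) ≤-refl y)
    ...   | inj₂ eq = done x (≤-reflexive (cong (toℕ ∘ row) (sym (to-injective F {c} {corner c d x} (toℕ-injective eq)))))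
    ...   | inj₁ lt = contradiction (se d c
              (≤-reflexive (cong (toℕ ∘ col) (to-injective F {d} {corner c d x} (toℕ-injective (≤-antisym
                (subst (Fin._≤ F $ corner c d x) (sym Fd) (1+i≤ i (subst (Fin._< F $ corner c d x) Fc lt)))
                (inc (corner c d x) d x ≤-refl))))))
              y) (<⇒≱ des)

  -- The extreme tableaux and the extreme readings

  private
    module 𝖳-reading  = Reading (byRows forwards forwards) (tcd α) (length-tcd′ α (rowByRow forwards forwards))
    module 𝖳′-reading = Reading (byColumns forwards forwards) (tcd α) (length-tcd′ α (columnByColumn forwards forwards))
    module RB-reading = Reading (byRows backwards forwards) (tcd α) (length-tcd′ α (rowByRow backwards forwards))
    module BR-reading = Reading (byColumns backwards forwards) (tcd α) (length-tcd′ α (columnByColumn backwards forwards))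

    RB BR : Fill
    RB = fill α (rowByRow backwards forwards)
    BR = fill α (columnByColumn backwards forwards)

  RB-SouthEast : SouthEast RB
  RB-SouthEast c d p q = ≮⇒≥ λ lt →
    [ (λ r → <⇒≱ r q) , (λ (_ , r) → <⇒≱ (opposite-<⁻ r) p) ]′ (RB-reading.pos-≺ c d lt)

  BR-SouthEast : SouthEast BR
  BR-SouthEast c d p q = ≮⇒≥ λ lt →
    [ (λ r → <⇒≱ (opposite-<⁻ r) p) , (λ (_ , r) → <⇒≱ r q) ]′ (BR-reading.pos-≺ c d lt)

  𝖳-Increasing : Increasing (𝖳 α)
  𝖳-Increasing c d p q = ≮⇒≥ λ lt →
    [ (λ r → <⇒≱ r q) , (λ (_ , r) → <⇒≱ r p) ]′ (𝖳-reading.pos-≺ d c lt)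

  𝖳′-Increasing : Increasing (𝖳′ α)
  𝖳′-Increasing c d p q = ≮⇒≥ λ lt →
    [ (λ r → <⇒≱ r p) , (λ (_ , r) → <⇒≱ r q) ]′ (𝖳′-reading.pos-≺ d c lt)

  -- Towards a cell to the south-east `𝖳 α` increases only within a row, where every increasing
  -- filling does so.
  𝖳≼ : (F : Fill) → Increasing F → 𝖳 α ≼ F
  𝖳≼ F inc c d p q lt =
    [ (λ r → contradiction q (<⇒≱ r))
    , (λ (eq , r) → ≤∧cell≢⇒< F (inc c d p (≤-reflexive eq)) (<⇒cell≢ (𝖳 α) {c} {d} lt))
    ]′ (𝖳-reading.pos-≺ c d lt)

  -- Towards a cell to the south-east an increasing filling cannot increase within a column, and
  -- from one column to a later one `𝖳′ α` always increases.
  ≼𝖳′ : (F : Fill) → Increasing F → F ≼ 𝖳′ α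
  ≼𝖳′ F inc c d p q lt =
    [ (λ r → 𝖳′-reading.pos-< c d (inj₁ r))
    , (λ eq → contradiction (inc d c (≤-reflexive (sym eq)) q) (<⇒≱ lt))
    ]′ (m≤n⇒m<n∨m≡n p)

  -- The words of all SETs under a fixed reading

  Readings : Fill → Pred (𝔖 N) 0ℓ
  Readings ω σ = Increasing (σ ↔-∘ ω)

  Readings-resp : (ω : Fill) {σ τ : 𝔖 N} → σ ≈ τ → σ ∈ Readings ω → τ ∈ Readings ω
  Readings-resp ω {σ} {τ} eq = Increasing-resp {σ ↔-∘ ω} {τ ↔-∘ ω} (λ c → eq (ω $ c))

  ⊘∈Readings : (F ω : Fill) → Increasing F → F ⊘ ω ∈ Readings ω
  ⊘∈Readings F ω = Increasing-resp {F} {(F ⊘ ω) ↔-∘ ω} (sym ∘ ↔-∘-⊘ F ω)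

  module _ (ω : Fill) (se : SouthEast ω) where

    Readings-⪯L⇒≼ : {σ τ : 𝔖 N} → σ ⪯L τ → σ ↔-∘ ω ≼ τ ↔-∘ ω
    Readings-⪯L⇒≼ {σ} {τ} le = ⊑⇒≼ (σ ↔-∘ ω) (τ ↔-∘ ω) ω se
      (≈⇒⊑ {σ = τ} {(τ ↔-∘ ω) ⊘ ω} (sym ∘ ⊘-↔-∘ τ ω) ∘ ⪯L⇒⊑ le ∘ ≈⇒⊑ {σ = (σ ↔-∘ ω) ⊘ ω} {σ} (⊘-↔-∘ σ ω))

    ≼⇒Readings-⪯L : {σ τ : 𝔖 N} → σ ∈ Readings ω → τ ∈ Readings ω → σ ↔-∘ ω ≼ τ ↔-∘ ω → σ ⪯L τ
    ≼⇒Readings-⪯L {σ} {τ} σ∈ τ∈ le = ⊑⇒⪯L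
      (≈⇒⊑ {σ = (τ ↔-∘ ω) ⊘ ω} {τ} (⊘-↔-∘ τ ω) ∘ ≼⇒⊑ (σ ↔-∘ ω) (τ ↔-∘ ω) ω se σ∈ τ∈ le ∘
       ≈⇒⊑ {σ = σ} {(σ ↔-∘ ω) ⊘ ω} (sym ∘ ⊘-↔-∘ σ ω))

    interval : LeftInterval N
    interval = record
      { bot = 𝖳 α ⊘ ω
      ; top = 𝖳′ α ⊘ ω
      ; bot⪯top = ⊑⇒⪯L (≼⇒⊑ (𝖳 α) (𝖳′ α) ω se 𝖳-Increasing 𝖳′-Increasing (𝖳≼ (𝖳′ α) 𝖳′-Increasing))
      }

    -- The bottom word inverts every pair of cells in one row, since `ω` and `𝖳 α` order a row
    -- oppositely; lying above it forces rows to increase. The top word inverts no pair in one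
    -- column; lying below it forces columns to increase.
    interval≐Readings : ⟦ interval ⟧ ≐ Readings ω
    interval≐Readings = to , from
      where
      to : ∀ {σ} → σ ∈ ⟦ interval ⟧ → σ ∈ Readings ω
      to {σ} (bot⪯σ , σ⪯top) = Increasing-intro (σ ↔-∘ ω)
        (λ c d eq lt → proj₂ (⪯L⇒⊑ bot⪯σ (inversion⁺ (𝖳 α) ω
          (≤∧cell≢⇒< ω (se c d (<⇒≤ lt) (≤-reflexive (cong toℕ (sym eq)))) λ { refl → <-irrefl refl lt })
          (𝖳-reading.pos-< c d (inj₂ (cong toℕ eq , lt))))))
        (λ c d eq lt → ≰⇒> λ σd≤σc →
          let ωc<ωd = ≤∧cell≢⇒< ω {c} {d} (se d c (≤-reflexive (cong toℕ (sym eq))) (<⇒≤ lt)) λ { refl → <-irrefl refl lt }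
              σd<σc = ≤∧≢⇒<F σd≤σc λ eq′ → <-irrefl (cong toℕ (sym (perm-injective σ eq′))) ωc<ωd
          in <⇒≱ (inversion⁻ (𝖳′ α) ω (⪯L⇒⊑ σ⪯top (ωc<ωd , σd<σc)))
                 (𝖳′-Increasing c d (≤-reflexive (cong toℕ eq)) (<⇒≤ lt)))
      from : ∀ {σ} → σ ∈ Readings ω → σ ∈ ⟦ interval ⟧
      from {σ} σ∈ =
        ⊑⇒⪯L (≈⇒⊑ {σ = (σ ↔-∘ ω) ⊘ ω} {σ} (⊘-↔-∘ σ ω) ∘
               ≼⇒⊑ (𝖳 α) (σ ↔-∘ ω) ω se 𝖳-Increasing σ∈ (𝖳≼ (σ ↔-∘ ω) σ∈)) ,
        ⊑⇒⪯L (≼⇒⊑ (σ ↔-∘ ω) (𝖳′ α) ω se σ∈ 𝖳′-Increasing (≼𝖳′ (σ ↔-∘ ω) σ∈) ∘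
               ≈⇒⊑ {σ = σ} {(σ ↔-∘ ω) ⊘ ω} (sym ∘ ⊘-↔-∘ σ ω))

  w-RB[SET]⇒Readings : ∀ {σ} → σ ∈ w-RB[SET] α → σ ∈ Readings RB
  w-RB[SET]⇒Readings {σ} ((F , set) , eq) =
    Readings-resp RB {F ⊘ RB} {σ} (sym ∘ eq) (⊘∈Readings F RB (IsSET⇒Increasing set))

  Readings⇒w-RB[SET] : ∀ {σ} → σ ∈ Readings RB → σ ∈ w-RB[SET] α
  Readings⇒w-RB[SET] {σ} σ∈ = ((σ ↔-∘ RB) , Increasing⇒IsSET σ∈) , sym ∘ ⊘-↔-∘ σ RB

  -- The isomorphism keeps the tableau and reads it by `RB` instead of `ω`. Both orders on words
  -- amount to `≼` on tableaux, and `descent-transfer` in both directions compares the descents.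
  Readings∈class : (ω : Fill) → SouthEast ω → (I : LeftInterval N) → ⟦ I ⟧ ≐ Readings ω → I ∈ C-X α
  Readings∈class ω se I (I⇒ , ⇒I) = f , record
    { isOrderMonomorphism = record
      { isOrderHomomorphism = record
        { cong = λ eq k → eq _
        ; mono = λ {γ} {δ} → mono γ δ
        }
      ; injective = λ {γ} {δ} eq k → subst (λ j → proj₁ γ ⟨$⟩ʳ j ≡ proj₁ δ ⟨$⟩ʳ j) (undo k) (eq (RB $ Inverse.from ω k))
      ; cancel = λ {γ} {δ} → cancel γ δ
      }
    ; surjective = surj
    } , λ γ → (λ {i} → des⁺ γ {i}) , (λ {i} → des⁻ γ {i})
    where
    undo : ∀ k → ω $ Inverse.from RB (RB $ Inverse.from ω k) ≡ k
    undo k = trans (cong (ω $_) (Inverse.strictlyInverseʳ RB _)) (Inverse.strictlyInverseˡ ω k)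
    g : 𝔖 N → 𝔖 N
    g γ = (γ ↔-∘ ω) ⊘ RB
    f : ∃ ⟦ I ⟧ → ∃ (w-RB[SET] α)
    f (γ , γ∈) = g γ , ((γ ↔-∘ ω) , Increasing⇒IsSET (I⇒ γ∈)) , λ _ → refl
    mono : (γ δ : ∃ ⟦ I ⟧) → proj₁ γ ⪯L proj₁ δ → g (proj₁ γ) ⪯L g (proj₁ δ)
    mono (γ , γ∈) (δ , δ∈) le = ⊑⇒⪯L (≼⇒⊑ (γ ↔-∘ ω) (δ ↔-∘ ω) RB RB-SouthEast (I⇒ γ∈) (I⇒ δ∈)
      (Readings-⪯L⇒≼ ω se le))
    cancel : (γ δ : ∃ ⟦ I ⟧) → g (proj₁ γ) ⪯L g (proj₁ δ) → proj₁ γ ⪯L proj₁ δ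
    cancel (γ , γ∈) (δ , δ∈) le = ≼⇒Readings-⪯L ω se (I⇒ γ∈) (I⇒ δ∈)
      (⊑⇒≼ (γ ↔-∘ ω) (δ ↔-∘ ω) RB RB-SouthEast (⪯L⇒⊑ le))
    surj : (y : ∃ (w-RB[SET] α)) → ∃ λ (x : ∃ ⟦ I ⟧) → ∀ {z : ∃ ⟦ I ⟧} → proj₁ z ≈ proj₁ x → g (proj₁ z) ≈ proj₁ y
    surj (τ , (F , set) , eq) = (F ⊘ ω , ⇒I (⊘∈Readings F ω (IsSET⇒Increasing set))) ,
      λ z≈ k → trans (z≈ _) (trans (↔-∘-⊘ F ω _) (sym (eq k)))
    des⁺ : (γ : ∃ ⟦ I ⟧) → ∀ {i} → i ∈ Des-L (g (proj₁ γ)) → i ∈ Des-L (proj₁ γ)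
    des⁺ (γ , γ∈) d = descent⇒Des-L γ (Descent-resp {σ = (γ ↔-∘ ω) ⊘ ω} {γ} (⊘-↔-∘ γ ω)
      (descent-transfer (γ ↔-∘ ω) RB ω (I⇒ γ∈) RB-SouthEast se (Des-L⇒descent (g γ) d)))
    des⁻ : (γ : ∃ ⟦ I ⟧) → ∀ {i} → i ∈ Des-L (proj₁ γ) → i ∈ Des-L (g (proj₁ γ))
    des⁻ (γ , γ∈) d = descent⇒Des-L (g γ) (descent-transfer (γ ↔-∘ ω) ω RB (I⇒ γ∈) se RB-SouthEast
      (Descent-resp {σ = γ} {(γ ↔-∘ ω) ⊘ ω} (sym ∘ ⊘-↔-∘ γ ω) (Des-L⇒descent γ d)))

  -- The reading attached to a member of the class

  module Class (I : LeftInterval N) (I∈C : I ∈ C-X α) where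

    RB⇒ : ∀ {σ} → σ ∈ ⟦ interval RB RB-SouthEast ⟧ → σ ∈ w-RB[SET] α
    RB⇒ {σ} σ∈ = Readings⇒w-RB[SET] {σ} (proj₁ (interval≐Readings RB RB-SouthEast) {σ} σ∈)

    ⇒RB : ∀ {σ} → σ ∈ w-RB[SET] α → σ ∈ ⟦ interval RB RB-SouthEast ⟧
    ⇒RB {σ} σ∈ = proj₂ (interval≐Readings RB RB-SouthEast) {σ} (w-RB[SET]⇒Readings {σ} σ∈)

    open DescentIsomorphism {X = ⟦ I ⟧} {w-RB[SET] α}
      (λ (p , _) (_ , q) σ⪯ρ ρ⪯τ → p ◅◅ σ⪯ρ , ρ⪯τ ◅◅ q)
      (λ {σ} {ρ} {τ} p q σ⪯ρ ρ⪯τ → RB⇒ {ρ} (proj₁ (⇒RB {σ} p) ◅◅ σ⪯ρ , ρ⪯τ ◅◅ proj₂ (⇒RB {τ} q)))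
      I∈C

    ⊥I : ∃ ⟦ I ⟧
    ⊥I = bot I , ε , bot⪯top I

    -- The least word read by `RB` has a preimage above `bot I`, so monotonicity gives one
    -- inequality; the other holds because that word is least.
    g-bot : g ⊥I ≈ 𝖳 α ⊘ RB
    g-bot = ⪯L-antisym
      (mono {⊥I} {proj₁ p} (proj₁ (proj₂ (proj₁ p))) ◅◅ ≈⇒⪯L (proj₂ p))
      (proj₁ (⇒RB (proj₂ (f ⊥I))))
      where
      p : ∃ λ γ → g γ ≈ 𝖳 α ⊘ RB
      p = preimage (𝖳 α ⊘ RB , RB⇒ (ε , bot⪯top (interval RB RB-SouthEast)))

    -- The choice is forced: `𝖳 α` read in this order has to give `bot I`.
    reading : Fill
    reading = ↔-sym (bot I) ↔-∘ 𝖳 α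

    -- At the bottom the right factor is the inverse of `bot I` times `𝖳 α ⊘ RB`, which is
    -- `reading ⊘ RB`; `translate` carries it to every member of the interval.
    g≈ : (γ : ∃ ⟦ I ⟧) → g γ ≈ (proj₁ γ ↔-∘ reading) ⊘ RB
    g≈ (γ , γ∈) k = trans
      (translate (proj₂ ⊥I) γ∈ (proj₁ γ∈) (Perm.flip (bot I) · g ⊥I) (λ k → sym (inverseʳ (bot I))) k)
      (cong (λ j → γ ⟨$⟩ʳ (bot I ⟨$⟩ˡ j)) (g-bot k))

    ≐Readings : ⟦ I ⟧ ≐ Readings reading
    ≐Readings = to , from
      where
      to : ∀ {γ} → γ ∈ ⟦ I ⟧ → γ ∈ Readings reading
      to {γ} γ∈ = Increasing-resp {g (γ , γ∈) ↔-∘ RB} {γ ↔-∘ reading}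
        (λ c → trans (g≈ (γ , γ∈) (RB $ c)) (↔-∘-⊘ (γ ↔-∘ reading) RB c))
        (w-RB[SET]⇒Readings {g (γ , γ∈)} (proj₂ (f (γ , γ∈))))
      from : ∀ {σ} → σ ∈ Readings reading → σ ∈ ⟦ I ⟧
      from {σ} σ∈ = proj₁ γ∈ ◅◅ ≈⇒⪯L γ≈σ , ≈⇒⪯L (sym ∘ γ≈σ) ◅◅ proj₂ γ∈
        where
        p = preimage ((σ ↔-∘ reading) ⊘ RB , Readings⇒w-RB[SET] {(σ ↔-∘ reading) ⊘ RB} (⊘∈Readings (σ ↔-∘ reading) RB σ∈))
        γ = proj₁ (proj₁ p)
        γ∈ = proj₂ (proj₁ p)
        cells : ∀ c → γ ⟨$⟩ʳ (reading $ c) ≡ σ ⟨$⟩ʳ (reading $ c)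
        cells c = trans (sym (↔-∘-⊘ (γ ↔-∘ reading) RB c))
          (trans (trans (sym (g≈ (proj₁ p) (RB $ c))) (proj₂ p (RB $ c))) (↔-∘-⊘ (σ ↔-∘ reading) RB c))
        γ≈σ : γ ≈ σ
        γ≈σ k = subst (λ j → γ ⟨$⟩ʳ j ≡ σ ⟨$⟩ʳ j) (Inverse.strictlyInverseˡ reading k) (cells (Inverse.from reading k))

    reading-descent : (F : Fill) → Increasing F → ∀ {i} →
      (Descent (F ⊘ RB) i → Descent (F ⊘ reading) i) × (Descent (F ⊘ reading) i → Descent (F ⊘ RB) i)
    reading-descent F inc =
      (λ d → g-descent⁻ γ (Descent-resp {σ = F ⊘ RB} {g γ} (sym ∘ gγ≈) d)) ,
      (λ d → Descent-resp {σ = g γ} {F ⊘ RB} gγ≈ (g-descent γ d))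
      where
      γ : ∃ ⟦ I ⟧
      γ = F ⊘ reading , proj₂ ≐Readings (⊘∈Readings F reading inc)
      gγ≈ : g γ ≈ F ⊘ RB
      gγ≈ k = trans (g≈ γ k) (↔-∘-⊘ F reading (Inverse.from RB k))

    -- The cells of one row carry consecutive entries of 𝖳 α, those of one column consecutive
    -- entries of 𝖳′ α, so the descents of these two tableaux determine all comparisons.
    reading-SouthEast : SouthEast reading
    reading-SouthEast = SouthEast-intro reading rows< cols<
      where
      open ≤-Reasoning
      rows< : ∀ c d → row c ≡ row d → col c Fin.< col d → reading $ d Fin.< reading $ c
      rows< c d eq lt = subst₂ (λ c d → reading $ d Fin.< reading $ c)
        (Inverse.strictlyInverseʳ (𝖳 α) c) (Inverse.strictlyInverseʳ (𝖳 α) d)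
        (chain {R = λ u v → reading $ at v Fin.< reading $ at u} (λ p q → <-trans q p) (𝖳 α $ d)
          (𝖳-reading.pos-< c d (inj₂ (cong toℕ eq , lt))) step)
        where
        at : Fin N → C
        at = Inverse.from (𝖳 α)
        step : ∀ i → 𝖳 α $ c Fin.≤ inject₁ i → suc i Fin.≤ 𝖳 α $ d → reading $ at (suc i) Fin.< reading $ at (inject₁ i)
        -- `RB` reads a row from right to left, so `i` is a descent of `𝖳 α ⊘ RB` and hence of
        -- `𝖳 α ⊘ reading`.
        step i p q = proj₁ (reading-descent (𝖳 α) 𝖳-Increasing {i})
          (≤∧cell≢⇒< RB {y} {x} (RB-SouthEast x y (x≤y-col) (≤-reflexive (cong toℕ (sym x≡y-row))))
            (<⇒cell≢ (𝖳 α) {x} {y} x<y ∘ sym))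
          where
          x = at (inject₁ i)
          y = at (suc i)
          x<y : 𝖳 α $ x Fin.< 𝖳 α $ y
          x<y = subst₂ Fin._<_ (sym (Inverse.strictlyInverseˡ (𝖳 α) (inject₁ i)))
                               (sym (Inverse.strictlyInverseˡ (𝖳 α) (suc i))) (i<1+i i)
          row-mono : ∀ a b → 𝖳 α $ a Fin.≤ 𝖳 α $ b → row a Fin.≤ row b
          row-mono a b le = ≮⇒≥ λ r → <⇒≱ (𝖳-reading.pos-< b a (inj₁ r)) le
          -- Row numbers grow weakly with the entries of `𝖳 α`, so cells with entries between those
          -- of `c` and `d` stay in their common row.
          x≡y-row : row x ≡ row y
          x≡y-row = toℕ-injective (≤-antisym (row-mono x y (<⇒≤ x<y)) (begin
            toℕ (row y) ≤⟨ row-mono y d (≤-trans (≤-reflexive (cong toℕ (Inverse.strictlyInverseˡ (𝖳 α) (suc i)))) q) ⟩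
            toℕ (row d) ≡⟨ cong toℕ (sym eq) ⟩
            toℕ (row c) ≤⟨ row-mono c x (≤-trans p (≤-reflexive (cong toℕ (sym (Inverse.strictlyInverseˡ (𝖳 α) (inject₁ i)))))) ⟩
            toℕ (row x) ∎))
          x≤y-col : col x Fin.≤ col y
          x≤y-col = ≮⇒≥ λ r → <⇒≱ (𝖳-reading.pos-< y x (inj₂ (cong toℕ (sym x≡y-row) , r))) (<⇒≤ x<y)

      cols< : ∀ c d → col c ≡ col d → row c Fin.< row d → reading $ c Fin.< reading $ d
      cols< c d eq lt = subst₂ (λ c d → reading $ c Fin.< reading $ d)
        (Inverse.strictlyInverseʳ (𝖳′ α) c) (Inverse.strictlyInverseʳ (𝖳′ α) d)
        (chain {R = λ u v → reading $ at u Fin.< reading $ at v} <-trans (𝖳′ α $ d)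
          (𝖳′-reading.pos-< c d (inj₂ (cong toℕ eq , lt))) step)
        where
        at : Fin N → C
        at = Inverse.from (𝖳′ α)
        step : ∀ i → 𝖳′ α $ c Fin.≤ inject₁ i → suc i Fin.≤ 𝖳′ α $ d → reading $ at (inject₁ i) Fin.< reading $ at (suc i)
        -- `RB` reads a column upwards, so `i` is an ascent of `𝖳′ α ⊘ RB`; a descent of
        -- `𝖳′ α ⊘ reading` would contradict this.
        step i p q = [ id , (λ des → contradiction (proj₂ (reading-descent (𝖳′ α) 𝖳′-Increasing {i}) des)
            (flip <⇒≱ (RB-SouthEast y x (≤-reflexive (cong toℕ (sym x≡y-col))) x≤y-row))) ]′
          (ascent⊎descent (𝖳′ α ⊘ reading) i)
          where
          x = at (inject₁ i)
          y = at (suc i)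
          x<y : 𝖳′ α $ x Fin.< 𝖳′ α $ y
          x<y = subst₂ Fin._<_ (sym (Inverse.strictlyInverseˡ (𝖳′ α) (inject₁ i)))
                               (sym (Inverse.strictlyInverseˡ (𝖳′ α) (suc i))) (i<1+i i)
          col-mono : ∀ a b → 𝖳′ α $ a Fin.≤ 𝖳′ α $ b → col a Fin.≤ col b
          col-mono a b le = ≮⇒≥ λ r → <⇒≱ (𝖳′-reading.pos-< b a (inj₁ r)) le
          x≡y-col : col x ≡ col y
          x≡y-col = toℕ-injective (≤-antisym (col-mono x y (<⇒≤ x<y)) (begin
            toℕ (col y) ≤⟨ col-mono y d (≤-trans (≤-reflexive (cong toℕ (Inverse.strictlyInverseˡ (𝖳′ α) (suc i)))) q) ⟩
            toℕ (col d) ≡⟨ cong toℕ (sym eq) ⟩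
            toℕ (col c) ≤⟨ col-mono c x (≤-trans p (≤-reflexive (cong toℕ (sym (Inverse.strictlyInverseˡ (𝖳′ α) (inject₁ i)))))) ⟩
            toℕ (col x) ∎))
          x≤y-row : row x Fin.≤ row y
          x≤y-row = ≮⇒≥ λ r → <⇒≱ (𝖳′-reading.pos-< y x (inj₂ (cong toℕ (sym x≡y-col) , r))) (<⇒≤ x<y)

  -- Passage to standard fillings of the reflected transpose

  transpose-cells : C ↔ Cell (𝓔 α)
  transpose-cells = mk↔ₛ′ (λ (b , p) → swap b , p) (λ (b , p) → swap b , p) (λ _ → refl) (λ _ → refl)

  -- The cell in column `x` and row `y` goes to column `y` and row `opposite x`, so the relation in
  -- `SouthEast`, read backwards, becomes `≤B`.
  flip-cells : C ↔ Cell (𝓔 α ˣ)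
  flip-cells = ↔-sym (reflectCell (𝓔 α)) ↔-∘ transpose-cells

  toST : Fill → Filling (𝓔 α ˣ) N
  toST ω = ω ↔-∘ ↔-sym flip-cells

  fromST : Filling (𝓔 α ˣ) N → Fill
  fromST F = F ↔-∘ flip-cells

  fromST-toST : (ω : Fill) → ∀ c → fromST (toST ω) $ c ≡ ω $ c
  fromST-toST ω c = cong (ω $_) (Inverse.strictlyInverseʳ flip-cells c)

  SouthEast⇒IsST : (ω : Fill) → SouthEast ω → IsST (toST ω)
  SouthEast⇒IsST ω se b c (p , q) = se (Inverse.from flip-cells c) (Inverse.from flip-cells b) (opposite-≤ q) p

  IsST⇒SouthEast : (F : Filling (𝓔 α ˣ) N) → IsST F → SouthEast (fromST F)
  IsST⇒SouthEast F st c d p q = st (Inverse.to flip-cells d) (Inverse.to flip-cells c) (q , opposite-≤ p)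

  -- Reflecting `F` cancels the reflection inside `flip-cells`; what remains is the coordinatewise
  -- order on the cells of `tcd α` with rows and columns exchanged.
  Σ-L≐Readings : (F : Filling (𝓔 α ˣ) N) → Σ-L (P (reflect F)) ≐ Readings (fromST F)
  Σ-L≐Readings F =
    (λ {σ} σ∈ c d p q → σ∈ (ω $ c) (ω $ d)
      (subst₂ (λ c d → row c Fin.≤ row d × col c Fin.≤ col d)
        (sym (Inverse.strictlyInverseʳ ω c)) (sym (Inverse.strictlyInverseʳ ω d)) (q , p))) ,
    (λ {σ} σ∈ i j (p , q) → subst₂ (λ i j → σ ⟨$⟩ʳ i Fin.≤ σ ⟨$⟩ʳ j)
      (Inverse.strictlyInverseˡ ω i) (Inverse.strictlyInverseˡ ω j)
      (σ∈ (Inverse.from ω i) (Inverse.from ω j) q p))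
    where
    ω : Fill
    ω = fromST F

  -- Columns of `𝓔 α ˣ` are rows of `tcd α` with the leftmost cell on top, so the reading visits the
  -- cells in the order of their entries in `𝖳 α`.
  w-TL≈ : (F : Filling (𝓔 α ˣ) N) → w-TL F ≈ fromST F ⊘ 𝖳 α
  w-TL≈ F k = cong (Inverse.to F) (begin
    Inverse.from TL.pos k
      ≡⟨ cong (Inverse.from TL.pos) (sym (trans (pos≡ _) (Inverse.strictlyInverseˡ (𝖳 α) k))) ⟩
    Inverse.from TL.pos (Inverse.to TL.pos (Inverse.to flip-cells (Inverse.from (𝖳 α) k)))
      ≡⟨ Inverse.strictlyInverseʳ TL.pos _ ⟩
    Inverse.to flip-cells (Inverse.from (𝖳 α) k) ∎)
    where
    open ≡-Reasoning
    module TL = Reading (byColumns forwards backwards) (𝓔 α ˣ)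
                  (↔⇒≡ (F ↔-∘ enumerate (columnByColumn forwards backwards) (𝓔 α ˣ)))
    pos≡ : ∀ c → Inverse.to TL.pos (Inverse.to flip-cells c) ≡ 𝖳 α $ c
    pos≡ = rigid (𝖳 α) (TL.pos ↔-∘ flip-cells) λ {c} {d} lt →
      TL.pos-< (Inverse.to flip-cells c) (Inverse.to flip-cells d)
        (Sum.map id (λ (eq , r) → eq , subst₂ Fin._<_
          (sym (opposite-involutive (col c))) (sym (opposite-involutive (col d))) r) (𝖳-reading.pos-≺ c d lt))

  -- Minimum and maximum of the class

  RB-min : (ω : Fill) → SouthEast ω → RB ⊘ 𝖳 α ⊑ ω ⊘ 𝖳 α
  -- `RB ⊘ 𝖳 α` inverts only pairs in one row, and every admissible reading inverts those.
  RB-min ω se = ⊑-intro RB ω (𝖳 α) λ c d p q →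
    [ (λ r → contradiction q (<-asym (RB-reading.pos-< c d (inj₁ r))))
    , (λ (eq , r) → ≤∧cell≢⇒< ω {d} {c} (se c d (<⇒≤ r) (≤-reflexive (sym eq))) (<⇒cell≢ RB {d} {c} q))
    ]′ (𝖳-reading.pos-≺ c d p)

  -- In a pair inverted by an admissible reading, the cell with the larger entry of `𝖳 α` is
  -- strictly further right, and `BR` reads it first.
  BR-max : (ω : Fill) → SouthEast ω → ω ⊘ 𝖳 α ⊑ BR ⊘ 𝖳 α
  BR-max ω se = ⊑-intro ω BR (𝖳 α) λ c d p q →
    BR-reading.pos-< d c (inj₁ (opposite-<
      ([ (λ r → ≰⇒> λ le → <⇒≱ q (se d c le (<⇒≤ r))) , proj₂ ]′ (𝖳-reading.pos-≺ c d p))))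

  -- This turns the comparison of bottom elements by `⪯R` into one of the words `ω ⊘ 𝖳 α` by `⪯L`.
  reading⊘𝖳 : (I : LeftInterval N) (I∈C : I ∈ C-X α) → Class.reading I I∈C ⊘ 𝖳 α ≈ Perm.flip (bot I)
  reading⊘𝖳 I I∈C k = cong (bot I ⟨$⟩ˡ_) (Inverse.strictlyInverseˡ (𝖳 α) k)

  interval∈class : (ω : Fill) (se : SouthEast ω) → interval ω se ∈ C-X α
  interval∈class ω se = Readings∈class ω se (interval ω se) (interval≐Readings ω se)

  RB-minimum : ∀ J → J ∈ C-X α → interval RB RB-SouthEast ⪯I J
  RB-minimum J J∈C = flip⪯L⇒⪯R (⊑⇒⪯L
    (≈⇒⊑ {σ = Class.reading J J∈C ⊘ 𝖳 α} {Perm.flip (bot J)} (reading⊘𝖳 J J∈C) ∘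
     RB-min (Class.reading J J∈C) (Class.reading-SouthEast J J∈C)))

  BR-maximum : ∀ J → J ∈ C-X α → J ⪯I interval BR BR-SouthEast
  BR-maximum J J∈C = flip⪯L⇒⪯R (⊑⇒⪯L
    (BR-max (Class.reading J J∈C) (Class.reading-SouthEast J J∈C) ∘
     ≈⇒⊑ {σ = Perm.flip (bot J)} {Class.reading J J∈C ⊘ 𝖳 α} (sym ∘ reading⊘𝖳 J J∈C)))

  -- `RB` and `𝖳 α` pass through the rows in the same order but along each row in opposite
  -- directions.
  𝖳⊘RB-w₀ : Is-w₀⟨ ∁ (set N (parts α)) ⟩ (𝖳 α ⊘ RB)
  𝖳⊘RB-w₀ = block-reversal (byRows backwards forwards) (byRows forwards forwards) (tcd α)
    (length-tcd′ α (rowByRow backwards forwards)) (length-tcd′ α (rowByRow forwards forwards))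
    (row-sizes α) (row-sizes α) opposite-<⁻

  -- The auxiliary `BB` reads columns from right to left, each downwards. It is `𝖳′ α` backwards,
  -- which contributes `w₀`, and it differs from `BR` by the reversal of each column, which
  -- contributes the longest element of the subgroup.
  𝖳′⊘BR-w₁ : Is-w₁⟨ set N (List.reverse (conjugate (sort↓ (parts α)))) ⟩ (𝖳′ α ⊘ BR)
  𝖳′⊘BR-w₁ = Perm.reverse , BB ⊘ BR , reverse-w₀ ,
    block-reversal (byColumns backwards forwards) (byColumns backwards backwards) (tcd α)
      (length-tcd′ α (columnByColumn backwards forwards)) (length-tcd′ α (columnByColumn backwards backwards))
      (column-sizes α) (column-sizes α) opposite-< ,
    λ k → sym (rigid (𝖳′ α) (Perm.reverse ↔-∘ BB) mono (Inverse.from BR k))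
    where
    module BB-reading = Reading (byColumns backwards backwards) (tcd α) (length-tcd′ α (columnByColumn backwards backwards))
    BB : Fill
    BB = fill α (columnByColumn backwards backwards)
    mono : ∀ {c d} → 𝖳′ α $ c Fin.< 𝖳′ α $ d → opposite (BB $ c) Fin.< opposite (BB $ d)
    mono {c} {d} lt = opposite-< (BB-reading.pos-< d c (Sum.map opposite-<
      (λ (eq , r) → cong (toℕ ∘ opposite) (toℕ-injective (sym eq)) , opposite-< r)
      (𝖳′-reading.pos-≺ c d lt)))

  -- The isomorphism between the class and the standard fillings

  classST : (I : LeftInterval N) → I ∈ C-X α → ST (𝓔 α ˣ) N
  classST I I∈C = toST (Class.reading I I∈C) ,
    SouthEast⇒IsST (Class.reading I I∈C) (Class.reading-SouthEast I I∈C)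

  Readings-≗ : (ω ω′ : Fill) → (∀ c → ω $ c ≡ ω′ $ c) → Readings ω ≐ Readings ω′
  Readings-≗ ω ω′ eq =
    (λ {σ} → Increasing-resp {σ ↔-∘ ω} {σ ↔-∘ ω′} (λ c → cong (σ ⟨$⟩ʳ_) (eq c))) ,
    (λ {σ} → Increasing-resp {σ ↔-∘ ω′} {σ ↔-∘ ω} (λ c → cong (σ ⟨$⟩ʳ_) (sym (eq c))))

  members : Members (C-X α) ≐ λ X → ∃ λ (T : ST (𝓔 α ˣ) N) → Σ-L (P (reflect (proj₁ T))) ≐ X
  members =
    (λ (I , I∈C , I≐X) → classST I I∈C ,
      ≐-trans (Σ-L≐Readings (proj₁ (classST I I∈C)))
      (≐-trans (Readings-≗ (fromST (toST (Class.reading I I∈C))) (Class.reading I I∈C) (fromST-toST (Class.reading I I∈C)))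
      (≐-trans (≐-sym (Class.≐Readings I I∈C)) I≐X))) ,
    (λ ((F , st) , ≐X) → let se = IsST⇒SouthEast F st in
      interval (fromST F) se , interval∈class (fromST F) se ,
      ≐-trans (interval≐Readings (fromST F) se) (≐-trans (≐-sym (Σ-L≐Readings F)) ≐X))

  ≈I⇒bot≈ : {I J : LeftInterval N} → I ≈I J → bot I ≈ bot J
  ≈I⇒bot≈ {I} {J} (I⊆J , J⊆I) = ⪯L-antisym (proj₁ (J⊆I (ε , bot⪯top J))) (proj₁ (I⊆J (ε , bot⪯top I)))

  w-TL-classST : (I : LeftInterval N) (I∈C : I ∈ C-X α) → w-TL (proj₁ (classST I I∈C)) ≈ Perm.flip (bot I)
  w-TL-classST I I∈C k = trans (w-TL≈ (toST (Class.reading I I∈C)) k)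
    (trans (fromST-toST (Class.reading I I∈C) _) (reading⊘𝖳 I I∈C k))

  -- The attached reading depends on the interval only through its bottom element.
  classST-cong : (I J : LeftInterval N) (I∈C : I ∈ C-X α) (J∈C : J ∈ C-X α) → I ≈I J → classST I I∈C ≈ST classST J J∈C
  classST-cong I J I∈C J∈C eq b = flip-cong {σ = bot I} {bot J} (≈I⇒bot≈ {I} {J} eq) _

  classST-injective : (I J : LeftInterval N) (I∈C : I ∈ C-X α) (J∈C : J ∈ C-X α) →
                      classST I I∈C ≈ST classST J J∈C → I ≈I J
  classST-injective I J I∈C J∈C eq = ≐-trans (Class.≐Readings I I∈C)
    (≐-trans (Readings-≗ (Class.reading I I∈C) (Class.reading J J∈C) same)
    (≐-sym (Class.≐Readings J J∈C)))
    where
    same : ∀ c → Class.reading I I∈C $ c ≡ Class.reading J J∈C $ c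
    same c = trans (sym (fromST-toST (Class.reading I I∈C) c))
      (trans (eq (Inverse.to flip-cells c)) (fromST-toST (Class.reading J J∈C) c))

  -- The interval built from `fromST F` has bottom `𝖳 α ⊘ fromST F`, from which the attached reading
  -- recovers `fromST F`.
  classST-surjective : (T : ST (𝓔 α ˣ) N) → ∃ λ (x : ∃ (C-X α)) →
    ∀ {z : ∃ (C-X α)} → proj₁ z ≈I proj₁ x → classST (proj₁ z) (proj₂ z) ≈ST T
  classST-surjective (F , st) = (interval (fromST F) se , interval∈class (fromST F) se) , λ {(J , J∈C)} J≈ b →
    trans (flip-cong {σ = bot J} {𝖳 α ⊘ fromST F} (≈I⇒bot≈ {J} {interval (fromST F) se} J≈) _)
      (cong (Inverse.to F) (trans (cong (Inverse.to flip-cells) (Inverse.strictlyInverseʳ (𝖳 α) _))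
        (Inverse.strictlyInverseˡ flip-cells b)))
    where
    se : SouthEast (fromST F)
    se = IsST⇒SouthEast F st

  -- Monotonicity in both directions comes from `w-TL-classST`: the word of the attached filling is
  -- the inverse of the bottom element.
  classST-isOrderIsomorphism :
    IsOrderIsomorphism (_≈I_ on proj₁) _≈ST_ (_⪯I_ on proj₁) _⊴_ (λ (I , I∈C) → classST I I∈C)
  classST-isOrderIsomorphism = record
    { isOrderMonomorphism = record
      { isOrderHomomorphism = record
        { cong = λ { {I , I∈C} {J , J∈C} → classST-cong I J I∈C J∈C }
        ; mono = λ { {I , I∈C} {J , J∈C} le →
            ≈⇒⪯L (w-TL-classST I I∈C) ◅◅ ⪯R⇒flip⪯L le ◅◅ ≈⇒⪯L (sym ∘ w-TL-classST J J∈C) }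
        }
      ; injective = λ { {I , I∈C} {J , J∈C} → classST-injective I J I∈C J∈C }
      ; cancel = λ { {I , I∈C} {J , J∈C} le → flip⪯L⇒⪯R
          (≈⇒⪯L (sym ∘ w-TL-classST I I∈C) ◅◅ le ◅◅ ≈⇒⪯L (w-TL-classST J J∈C)) }
      }
    ; surjective = classST-surjective
    }

  []L-cong : {σ σ′ τ τ′ : 𝔖 N} → σ ≈ σ′ → τ ≈ τ′ → [ σ , τ ]L ≐ [ σ′ , τ′ ]L
  []L-cong eq eq′ =
    (λ (p , q) → ≈⇒⪯L (sym ∘ eq) ◅◅ p , q ◅◅ ≈⇒⪯L eq′) ,
    (λ (p , q) → ≈⇒⪯L eq ◅◅ p , q ◅◅ ≈⇒⪯L (sym ∘ eq′))

  minimum : Σ[ σ ∈ 𝔖 N ] Is-w₀⟨ ∁ (set N (parts α)) ⟩ σ × MinIs (C-X α) [ σ , w-RB (𝖳′ α) ]L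
  minimum = 𝖳 α ⊘ RB , 𝖳⊘RB-w₀ , interval RB RB-SouthEast , interval∈class RB RB-SouthEast , RB-minimum ,
    []L-cong {𝖳 α ⊘ RB} {𝖳 α ⊘ RB} {𝖳′ α ⊘ RB} {w-RB (𝖳′ α)} (λ _ → refl) (λ _ → refl)

  maximum : Σ[ τ ∈ 𝔖 N ] Is-w₁⟨ set N (List.reverse (conjugate (sort↓ (parts α)))) ⟩ τ
                    × MaxIs (C-X α) [ w-BR (𝖳 α) , τ ]L
  maximum = 𝖳′ α ⊘ BR , 𝖳′⊘BR-w₁ , interval BR BR-SouthEast , interval∈class BR BR-SouthEast , BR-maximum ,
    []L-cong {𝖳 α ⊘ BR} {w-BR (𝖳 α)} {𝖳′ α ⊘ BR} {𝖳′ α ⊘ BR} (λ _ → refl) (λ _ → refl)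

proposition5p8 : (n : ℕ) .{{_ : NonZero n}} (α : Composition n) →
    ( (Members (C-X α) ≐ λ X → Σ[ T ∈ ST (𝓔 α ˣ) n ] Σ-L (P (reflect (proj₁ T))) ≐ X)
    × (Σ[ σ ∈ 𝔖 n ] Is-w₀⟨ ∁ (set n (parts α)) ⟩ σ × MinIs (C-X α) [ σ , w-RB (𝖳′ α) ]L)
    × (Σ[ τ ∈ 𝔖 n ] Is-w₁⟨ set n (reverse (conjugate (sort↓ (parts α)))) ⟩ τ × MaxIs (C-X α) [ w-BR (𝖳 α) , τ ]L)
    )
    ×
    (Σ[ f ∈ (∃ (C-X α) → ST (𝓔 α ˣ) n) ]
    IsOrderIsomorphism (_≈I_ on proj₁) _≈ST_ (_⪯I_ on proj₁) _⊴_ f)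
proposition5p8 (suc n) α =
  (members α , minimum α , maximum α) , (λ (I , I∈C) → classST α I I∈C) , classST-isOrderIsomorphism α
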